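{- Let $r,m\ge 1$. Consider the labeled chip-firing process on the line with $r$ copies of each edge, starting with $2rm$ chips with distinct labels from a totally ordered set, all at site $0$. In the final configuration (when no firing move is possible), for all chips $a$ and $b$ with $a<b$, the final position of $a$ is at or to the left of the final position of $b$, regardless of the choices of firing moves made.
   Context: The graph is $\mathbb{Z}$ with $r$ parallel edges between $i$ and $i+1$ for each integer $i$. A firing move consists of choosing $2r$ chips located at a common site $i$ and sending the $r$ chips with the smallest labels among them to site $i-1$ and the $r$ chips with the largest labels to site $i+1$. The process terminates when every site has fewer than $2r$ chips. -}

module Defs where

open import Level using (Level)
open import Data.Nat.Base using (ℕ; _*_)
open import Data.Integer.Base using (ℤ; 0ℤ; 1ℤ; _+_; _-_)
open import Data.Fin.Base using (Fin)
open import Data.Fin.Subset using (Subset; _∈_; _∉_; _∪_; ∣_∣)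
open import Relation.Binary.Bundles using (StrictTotalOrder)
open import Relation.Binary.Construct.Closure.ReflexiveTransitive using (Star)
open import Relation.Binary.PropositionalEquality.Core using (_≡_)
open import Relation.Nullary.Negation.Core using (¬_)

-- Chips are indexed by Fin n; the index is only a name, and the order between
-- chips is always that of their labels.  A configuration maps a chip to its site.
Config : ℕ → Set
Config n = Fin n → ℤ

allAtOrigin : ∀ {n} → Config n
allAtOrigin _ = 0ℤ

module LabeledChipFiring
  {c ℓ₁ ℓ₂ : Level} (O : StrictTotalOrder c ℓ₁ ℓ₂) (r : ℕ)
  {n : ℕ} (label : Fin n → StrictTotalOrder.Carrier O)
  where

  open StrictTotalOrder O using (_<_)

  -- Since `split` and `sorted` divide the 2r chosen chips into two sets of size r
  -- with every label of `left` below every label of `right`, these are the r chips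
  -- with the smallest and the r chips with the largest labels among those chosen.
  record _⟶_ (p q : Config n) : Set ℓ₂ where
    field
      site   : ℤ
      chosen : Subset n
      size   : ∣ chosen ∣ ≡ 2 * r
      atSite : ∀ a → a ∈ chosen → p a ≡ site

      left right : Subset n
      split      : left ∪ right ≡ chosen
      leftSize   : ∣ left ∣ ≡ r
      rightSize  : ∣ right ∣ ≡ r
      sorted     : ∀ a b → a ∈ left → b ∈ right → label a < label b

      movesLeft  : ∀ a → a ∈ left → q a ≡ site - 1ℤ
      movesRight : ∀ a → a ∈ right → q a ≡ site + 1ℤ
      stays      : ∀ a → a ∉ chosen → q a ≡ p a

  infix 4 _⟶_ _⟶*_

  _⟶*_ : Config n → Config n → Set ℓ₂
  _⟶*_ = Star _⟶_

  Final : Config n → Set ℓ₂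
  Final p = ∀ q → ¬ (p ⟶ q)

{-# OPTIONS --safe #-}

-- Fix a threshold label and call the K chips up to it small; it is enough that no small chip
-- ends to the right of a large one, and by reflecting the line we may assume K ≤ r m.  Let
-- u i be the number of firings of site i still to come, out of the triangular number
-- 1 + ⋯ + (m - |i|).  Once u i < m - |i|, the firings of neighbouring sites are forced to
-- interlace, and every site that fires holds exactly 2r chips.  The last firings thus form an
-- m × m grid of comparators on bundles of r chips, with bundles moving left (columns, keeping
-- small chips) crossing bundles moving right.  Before the endgame the small chips at sites
-- ≥ i > 0 number at most max (0, K - r i), because r of them stay behind at each site; the
-- grid turns this into the invariant that for each column b the small chips at or right of a
-- site which column b has left behind number at most max (0, K - r b).  At the end u = 0, and
-- these bounds say that the small chips fill the leftmost sites.
module Submission where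

module Development where

  open import Algebra.Properties.AbelianGroup using (∙-cancelˡ)
  open import Data.Bool.Base using (true; false; if_then_else_)
  open import Data.Empty using (⊥)
  open import Data.Fin.Base using (Fin; zero; suc)
  import Data.Fin.Properties as Fin
  open import Data.Fin.Subset using (Subset; Nonempty; _∈_; _∉_; _⊆_; _∪_; _─_; ⁅_⁆) renaming (∣_∣ to size)
  import Data.Fin.Subset as Subset
  open import Data.Fin.Subset.Properties
  open import Data.Integer.Base hiding (suc; pred)
  open import Data.Integer.Properties
  open import Data.Integer.Tactic.RingSolver using (solve)
  open import Data.List.Base using ([]; _∷_)
  open import Data.Nat.Base using (ℕ)
  import Data.Nat.Base as ℕ
  import Data.Nat.Properties as ℕ
  open import Data.Product.Base using (∃; _×_; _,_)
  open import Data.Sum.Base using (_⊎_; inj₁; inj₂; [_,_]′; map₂)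
  open import Data.Vec.Base as Vec using (lookup; tabulate)
  import Data.Vec.Functional as Vector
  open import Data.Vec.Properties using (lookup∘tabulate; []=⇒lookup; lookup⇒[]=)
  open import Defs
  open import Function.Base using (_∘_)
  open import Function.Definitions using (Injective)
  open import Level using (Level)
  open import Relation.Binary.Bundles using (StrictTotalOrder)
  open import Relation.Binary.Construct.Closure.ReflexiveTransitive using (ε; _◅_)
  open import Relation.Binary.Definitions using (tri<; tri≈; tri>)
  open import Relation.Binary.PropositionalEquality
  open import Relation.Nullary using (¬_; Dec; yes; no; does; contradiction)
  open import Relation.Nullary.Decidable using (dec-true; dec-false; _×-dec_; ¬?)

  -- Linear inequalities over the integers

  infixr 5 _⊹_
  _⊹_ : ∀ {a b c d} → a ≤ b → c ≤ d → a + c ≤ b + d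
  _⊹_ = +-mono-≤

  -- Transfers an inequality along an equality of differences, so that a linear
  -- consequence reduces to a ring identity.
  infix 4 _⊢_
  _⊢_ : ∀ {a b x y} → x ≤ y → b - a ≡ y - x → a ≤ b
  p ⊢ eq = 0≤i-j⇒j≤i (subst (0ℤ ≤_) (sym eq) (i≤j⇒0≤j-i p))

  0≤+ : ∀ n → 0ℤ ≤ + n
  0≤+ n = +≤+ ℕ.z≤n

  1≰0 : ∀ {a} {A : Set a} → 1ℤ ≤ 0ℤ → A
  1≰0 (+≤+ ())

  below-or-above : ∀ x y → x + 1ℤ ≤ y ⊎ y ≤ x
  below-or-above x y with y ≤? x
  ... | yes y≤x = inj₂ y≤x
  ... | no y≰x = inj₁ (subst (_≤ y) (+-comm 1ℤ x) (i<j⇒suc[i]≤j (≰⇒> y≰x)))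

  -- Integrality absorbs the odd 1. Heights contain doubled firing counts, so bounds on firing
  -- counts arrive in this form.
  half-≤ : ∀ x y → x + x ≤ y + y + 1ℤ → x ≤ y
  half-≤ x y p with below-or-above y x
  ... | inj₂ x≤y = x≤y
  ... | inj₁ y<x = 1≰0 (p ⊹ y<x ⊹ y<x ⊢ solve (x ∷ y ∷ []))

  -- Sites of the line

  -- The Kronecker delta, integer-valued so that the effect of a firing is one ring expression valid
  -- at all sites.
  κ : ℤ → ℤ → ℤ
  κ i j = if does (i ≟ j) then 1ℤ else 0ℤ

  κ-refl : ∀ {i j} → i ≡ j → κ i j ≡ 1ℤ
  κ-refl {i} {j} i≡j rewrite dec-true (i ≟ j) i≡j = refl

  κ-≢ : ∀ {i j} → ¬ i ≡ j → κ i j ≡ 0ℤ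
  κ-≢ {i} {j} i≢j rewrite dec-false (i ≟ j) i≢j = refl

  0≤κ : ∀ i j → 0ℤ ≤ κ i j
  0≤κ i j with i ≟ j
  ... | yes _ = +≤+ ℕ.z≤n
  ... | no _ = ≤-refl

  κ-cong : ∀ {i j i′ j′} → (i ≡ j → i′ ≡ j′) → (i′ ≡ j′ → i ≡ j) → κ i j ≡ κ i′ j′
  κ-cong {i} {j} {i′} {j′} f g with i ≟ j
  ... | yes p = sym (κ-refl (f p))
  ... | no ¬p = sym (κ-≢ λ q → ¬p (g q))

  suc-injective : ∀ {i j} → 1ℤ + i ≡ 1ℤ + j → i ≡ j
  suc-injective {i} {j} = ∙-cancelˡ +-0-abelianGroup 1ℤ i j

  suc≢ : ∀ i → ¬ 1ℤ + i ≡ i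
  suc≢ i eq = 1≰0 (≤-reflexive eq ⊢ solve (i ∷ []))

  -- A relation rather than a function, so that either site may be the given one: matching on `next`
  -- replaces the right site, while `adj-pred` reaches the left one, where `1ℤ + (-1ℤ + j)` does not
  -- reduce to `j`.
  data Adj (i : ℤ) : ℤ → Set where
    next : Adj i (1ℤ + i)

  adj-≡ : ∀ {i j} → Adj i j → j ≡ 1ℤ + i
  adj-≡ next = refl

  Near : ℤ → ℤ → Set
  Near i j = Adj i j ⊎ Adj j i

  near-sym : ∀ {i j} → Near i j → Near j i
  near-sym (inj₁ p) = inj₂ p
  near-sym (inj₂ p) = inj₁ p

  near-≢ : ∀ {i j} → Near i j → ¬ j ≡ i
  near-≢ (inj₁ next) = suc≢ _
  near-≢ (inj₂ next) eq = suc≢ _ (sym eq)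

  adj-pred : ∀ j → Adj (-1ℤ + j) j
  adj-pred j = subst (Adj (-1ℤ + j)) (-1+ j) next
    where
    -1+ : ∀ j → 1ℤ + (-1ℤ + j) ≡ j
    -1+ j = solve (j ∷ [])

  abs : ℤ → ℤ
  abs (+ n) = + n
  abs (-[1+ n ]) = +[1+ n ]

  abs-cases : ∀ i → abs i ≡ i ⊎ abs i ≡ - i
  abs-cases (+ _) = inj₁ refl
  abs-cases -[1+ _ ] = inj₂ refl

  -- No edge crosses the origin, so on each edge `abs` is linear, with one sign for both ends.
  adj-side : ∀ {i j} → Adj i j →
    (0ℤ ≤ i × abs i ≡ i × abs j ≡ j) ⊎ (j ≤ 0ℤ × abs i ≡ - i × abs j ≡ - j)
  adj-side {+ n} next = inj₁ (+≤+ ℕ.z≤n , refl , refl)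
  adj-side { -[1+ ℕ.zero ]} next = inj₂ (≤-refl , refl , refl)
  adj-side { -[1+ ℕ.suc n ]} next = inj₂ (-≤+ , refl , refl)

  near-abs : ∀ {i j} → Near i j → abs j ≤ abs i + 1ℤ
  near-abs {i} (inj₁ next) with adj-side {i} next
  ... | inj₁ (_ , a , b) rewrite a | b = ≤-refl {i} ⊢ solve (i ∷ [])
  ... | inj₂ (_ , a , b) rewrite a | b = 0≤+ 2 ⊢ solve (i ∷ [])
  near-abs {_} {j} (inj₂ next) with adj-side {j} next
  ... | inj₁ (_ , a , b) rewrite a | b = 0≤+ 2 ⊢ solve (j ∷ [])
  ... | inj₂ (_ , a , b) rewrite a | b = ≤-refl {j} ⊢ solve (j ∷ [])

  abs-convex : ∀ {l j k} → Adj l j → Adj j k → abs j + abs j ≤ abs l + abs k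
  abs-convex {l} next next with adj-side {l} next | adj-side {1ℤ + l} next
  ... | inj₁ (_ , a , b) | inj₁ (_ , c , d) rewrite a | b | d = ≤-refl {l} ⊢ solve (l ∷ [])
  ... | inj₂ (_ , a , b) | inj₂ (_ , c , d) rewrite a | b | d = ≤-refl {l} ⊢ solve (l ∷ [])
  ... | inj₂ (p , a , b) | inj₁ (q , c , d) rewrite a | b | d = q ⊹ q ⊹ 0≤+ 2 ⊢ solve (l ∷ [])
  ... | inj₁ (p , _ , _) | inj₂ (q , _ , _) = 1≰0 (p ⊹ q ⊹ 0≤+ 1 ⊢ solve (l ∷ []))

  -- The unlabeled process

  triangle : ℕ → ℕ
  triangle ℕ.zero = 0
  triangle (ℕ.suc n) = ℕ.suc n ℕ.+ triangle n

  n≤triangle : ∀ n → n ℕ.≤ triangle n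
  n≤triangle ℕ.zero = ℕ.z≤n
  n≤triangle (ℕ.suc n) = ℕ.m≤m+n (ℕ.suc n) _

  triangle-∸ : ∀ m n → + triangle (m ℕ.∸ n) ≡ + (m ℕ.∸ n) + + triangle (m ℕ.∸ ℕ.suc n)
  triangle-∸ ℕ.zero ℕ.zero = refl
  triangle-∸ ℕ.zero (ℕ.suc n) = refl
  triangle-∸ (ℕ.suc m) ℕ.zero = refl
  triangle-∸ (ℕ.suc m) (ℕ.suc n) = triangle-∸ m n

  ∸-drop : ∀ m n → + (m ℕ.∸ n) ≤ + (m ℕ.∸ ℕ.suc n) + 1ℤ
  ∸-drop ℕ.zero ℕ.zero = 0≤+ 1
  ∸-drop ℕ.zero (ℕ.suc n) = 0≤+ 1
  ∸-drop (ℕ.suc m) ℕ.zero = ≤-reflexive (+-comm 1ℤ (+ m))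
  ∸-drop (ℕ.suc m) (ℕ.suc n) = ∸-drop m n

  ∸-drop-< : ∀ {m n} → n ℕ.< m → + (m ℕ.∸ ℕ.suc n) + 1ℤ ≡ + (m ℕ.∸ n)
  ∸-drop-< {ℕ.suc m} {ℕ.zero} _ = +-comm (+ m) 1ℤ
  ∸-drop-< {ℕ.suc m} {ℕ.suc n} (ℕ.s≤s p) = ∸-drop-< p

  module Profile (m : ℕ) where

    M : ℤ
    M = + m

    -- The number of chips at or right of a site in the final configuration, in units of r.
    final : ℤ → ℤ
    final +0 = M
    final +[1+ n ] = + (m ℕ.∸ n)
    final -[1+ n ] = M + M - + (m ℕ.∸ ℕ.suc n)

    -- How often each site fires in the whole process.
    odometer : ℤ → ℤ
    odometer i = + triangle (m ℕ.∸ ∣ i ∣)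

    -- Consecutive odometer values differ by `m ∸ n`, which is `final` there: undoing all firings
    -- leaves nothing right of the origin. Likewise `final-left` recovers the whole stock of `M + M`
    -- bundles.
    final-right : ∀ {l} n → Adj l +[1+ n ] → 0ℤ ≡ final +[1+ n ] - odometer l + odometer +[1+ n ]
    final-right {l} n adj with suc-injective {+ n} {l} (adj-≡ adj)
    ... | refl rewrite triangle-∸ m n = go (+ (m ℕ.∸ n)) (+ triangle (m ℕ.∸ ℕ.suc n))
      where
      go : ∀ x y → 0ℤ ≡ x - (x + y) + y
      go x y = solve (x ∷ y ∷ [])

    final-left : ∀ {l j} → j ≤ 0ℤ → Adj l j → M + M ≡ final j - odometer l + odometer j
    final-left {l} {+ 0} _ adj with suc-injective { -1ℤ} {l} (adj-≡ adj)
    ... | refl rewrite triangle-∸ m 0 = go M (+ triangle (m ℕ.∸ 1))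
      where
      go : ∀ x y → x + x ≡ x - y + (x + y)
      go x y = solve (x ∷ y ∷ [])
    final-left {j = +[1+ n ]} (+≤+ ()) _
    final-left {l} { -[1+ n ]} _ adj with suc-injective { -[1+ ℕ.suc n ]} {l} (adj-≡ adj)
    ... | refl rewrite triangle-∸ m (ℕ.suc n) =
      go M (+ (m ℕ.∸ ℕ.suc n)) (+ triangle (m ℕ.∸ ℕ.suc (ℕ.suc n)))
      where
      go : ∀ z x y → z + z ≡ z + z - x - y + (x + y)
      go z x y = solve (x ∷ y ∷ z ∷ [])

    -- A triangular number is at least its index. Hence no site is in the endgame at the start.
    odometer-lower : ∀ i → M ≤ odometer i + abs i
    odometer-lower i = ≤-trans
      (+≤+ (ℕ.≤-trans (ℕ.m≤n+m∸n m ∣ i ∣) (ℕ.+-monoʳ-≤ ∣ i ∣ (n≤triangle (m ℕ.∸ ∣ i ∣)))))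
      (≤-reflexive (go i))
      where
      go : ∀ i → + (∣ i ∣ ℕ.+ triangle (m ℕ.∸ ∣ i ∣)) ≡ odometer i + abs i
      go (+ n) = +-comm (+ n) (odometer (+ n))
      go -[1+ n ] = +-comm (+[1+ n ]) (odometer -[1+ n ])

    odometer-outside : ∀ i → M ≤ abs i → odometer i ≤ 0ℤ
    odometer-outside (+ n) (+≤+ m≤n) rewrite ℕ.m≤n⇒m∸n≡0 m≤n = ≤-refl
    odometer-outside -[1+ n ] (+≤+ m≤n) rewrite ℕ.m≤n⇒m∸n≡0 m≤n = ≤-refl

    -- The final load `final j - final k` is 0 at the origin and beyond distance `m`, and 1
    -- elsewhere; the right side is 0 at the origin and 2 elsewhere.
    final-gap : ∀ {l j k} → Adj l j → Adj j k →
      (final j - final k) + (final j - final k) ≤ + 2 + (abs j + abs j) - abs l - abs k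
    final-gap {+ n} next next =
      ∸-drop m n ⊹ ∸-drop m n ⊢ go (+ (m ℕ.∸ n)) (+ (m ℕ.∸ ℕ.suc n)) (+ n)
      where
      go : ∀ x y n → + 2 + ((1ℤ + n) + (1ℤ + n)) - n - (+ 2 + n) - (x - y + (x - y)) ≡
        y + 1ℤ + (y + 1ℤ) - (x + x)
      go x y n = solve (x ∷ y ∷ n ∷ [])
    final-gap { -[1+ 0 ]} next next = ≤-refl {0ℤ} ⊢ go M
      where
      go : ∀ x → 0ℤ - (x - x + (x - x)) ≡ 0ℤ
      go x = solve (x ∷ [])
    final-gap { -[1+ 1 ]} next next = ∸-drop m 0 ⊹ ∸-drop m 0 ⊢ go M (+ (m ℕ.∸ 1))
      where
      go : ∀ x y → + 2 - (x + x - y - x + (x + x - y - x)) ≡ y + 1ℤ + (y + 1ℤ) - (x + x)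
      go x y = solve (x ∷ y ∷ [])
    final-gap { -[1+ ℕ.suc (ℕ.suc n) ]} next next =
      ∸-drop m (ℕ.suc n) ⊹ ∸-drop m (ℕ.suc n) ⊢
      go M (+ (m ℕ.∸ ℕ.suc n)) (+ (m ℕ.∸ ℕ.suc (ℕ.suc n))) (+ n)
      where
      go : ∀ z x y n → + 2 + ((+ 2 + n) + (+ 2 + n)) - (+ 3 + n) - (1ℤ + n) -
        ((z + z - y - (z + z - x)) + (z + z - y - (z + z - x))) ≡
        y + 1ℤ + (y + 1ℤ) - (x + x)
      go z x y n = solve (x ∷ y ∷ z ∷ n ∷ [])

  -- Interlacing of firings in the endgame

  module Endgame (m : ℕ) where
    open Profile m

    -- The first of the last m - |i| firings of i has taken place.
    InEndgame : (ℤ → ℤ) → ℤ → Set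
    InEndgame u i = u i + abs i + 1ℤ ≤ M

    -- By `final-gap`, twice the load of `j` is at most 2 minus the second difference of `height` at
    -- `j`; so a site that can fire lies above the mean of its neighbours.
    height : (ℤ → ℤ) → ℤ → ℤ
    height u i = u i + u i + abs i

    -- In the endgame u is unimodal with steps at most 1 on each side of the origin, so that
    -- the firings of neighbouring sites interlace.
    Gradual : (ℤ → ℤ) → Set
    Gradual u = ∀ {i k} → Near i k → InEndgame u i → height u k ≤ height u i + 1ℤ

    -- The number of chips at j, in units of r, when u counts the firings still to come.
    load : (ℤ → ℤ) → ℤ → ℤ → ℤ → ℤ
    load u l j k = final j - final k + (u j + u j) - (u l + u k)

    Fireable : (ℤ → ℤ) → ℤ → Set
    Fireable u j = ∀ {l k} → Adj l j → Adj j k → + 2 ≤ load u l j k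

    fire : (ℤ → ℤ) → ℤ → ℤ → ℤ
    fire u j i = u i - κ i j

    fire-at : ∀ u j → fire u j j ≡ u j - 1ℤ
    fire-at u j = cong (λ x → u j - x) (κ-refl {j} refl)

    fire-away : ∀ u {i j} → ¬ i ≡ j → fire u j i ≡ u i
    fire-away u {i} i≢j = trans (cong (λ x → u i - x) (κ-≢ i≢j)) (+-identityʳ (u i))

    fire-≤ : ∀ u j i → fire u j i ≤ u i
    fire-≤ u j i = go (u i) (κ i j) (0≤κ i j)
      where
      go : ∀ x y → 0ℤ ≤ y → x - y ≤ x
      go x y p = p ⊢ solve (x ∷ y ∷ [])

    initially-gradual : Gradual odometer
    initially-gradual {i} _ p = 1≰0 (go (odometer i) (abs i) M p (odometer-lower i))
      where
      go : ∀ x y z → x + y + 1ℤ ≤ z → z ≤ x + y → 1ℤ ≤ 0ℤ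
      go x y z p q = p ⊹ q ⊢ solve (x ∷ y ∷ z ∷ [])

    -- Naming the neighbour other than `k` by `o` lets later arguments ignore on which side `k`
    -- lies.
    fireable-height : ∀ u {j k} → Fireable u j → Near j k →
      ∃ λ o → Near j o × height u o + height u k + + 2 ≤ height u j + height u j
    fireable-height u {j} {k} f (inj₁ adj) =
      -1ℤ + j , inj₂ (adj-pred j) ,
      go (final j - final k) (u j) (u (-1ℤ + j)) (u k) (abs j) (abs (-1ℤ + j)) (abs k)
         (f (adj-pred j) adj) (final-gap (adj-pred j) adj)
      where
      go : ∀ d x y z X Y Z → + 2 ≤ d + (x + x) - (y + z) → d + d ≤ + 2 + (X + X) - Y - Z →
        (y + y + Y) + (z + z + Z) + + 2 ≤ (x + x + X) + (x + x + X)
      go d x y z X Y Z p q = p ⊹ p ⊹ q ⊢ solve (d ∷ x ∷ y ∷ z ∷ X ∷ Y ∷ Z ∷ [])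
    fireable-height u {j} {k} f (inj₂ adj) =
      1ℤ + j , inj₁ next ,
      go (final j - final (1ℤ + j)) (u j) (u k) (u (1ℤ + j)) (abs j) (abs k) (abs (1ℤ + j))
         (f adj next) (final-gap adj next)
      where
      go : ∀ d x y z X Y Z → + 2 ≤ d + (x + x) - (y + z) → d + d ≤ + 2 + (X + X) - Y - Z →
        (z + z + Z) + (y + y + Y) + + 2 ≤ (x + x + X) + (x + x + X)
      go d x y z X Y Z p q = p ⊹ p ⊹ q ⊢ solve (d ∷ x ∷ y ∷ z ∷ X ∷ Y ∷ Z ∷ [])

    -- A site that has used up its firings holds at most its final load, which is at most 1: firings
    -- still to come at the neighbours can only add to it.
    fireable-positive : ∀ u {j} → (∀ i → 0ℤ ≤ u i) → Fireable u j → 1ℤ ≤ u j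
    fireable-positive u {j} u≥0 f =
      half-≤ 1ℤ (u j) (go (final j - final (1ℤ + j)) (u j) (u (-1ℤ + j)) (u (1ℤ + j))
        (abs j) (abs (-1ℤ + j)) (abs (1ℤ + j))
        (f (adj-pred j) next) (final-gap (adj-pred j) next) (abs-convex (adj-pred j) next)
        (u≥0 (-1ℤ + j)) (u≥0 (1ℤ + j)))
      where
      d≤1 : ∀ d X Y Z → d + d ≤ + 2 + (X + X) - Y - Z → X + X ≤ Y + Z → d ≤ 1ℤ
      d≤1 d X Y Z p q = half-≤ d 1ℤ (p ⊹ q ⊹ 0≤+ 1 ⊢ solve (d ∷ X ∷ Y ∷ Z ∷ []))
      go : ∀ d x y z X Y Z → + 2 ≤ d + (x + x) - (y + z) → d + d ≤ + 2 + (X + X) - Y - Z →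
        X + X ≤ Y + Z → 0ℤ ≤ y → 0ℤ ≤ z → + 2 ≤ x + x + 1ℤ
      go d x y z X Y Z p q s y≥0 z≥0 = p ⊹ d≤1 d X Y Z q s ⊹ y≥0 ⊹ z≥0 ⊢ solve (d ∷ x ∷ y ∷ z ∷ [])

    -- Otherwise the neighbour o on the other side is so low that it is in the endgame as well,
    -- and then o violates gradualness towards j.
    fired-neighbour-below : ∀ u {j k} → Gradual u → Fireable u j → Near j k →
      u j + abs j ≤ M → height u k + 1ℤ ≤ height u j
    fired-neighbour-below u {j} {k} grad f near end with below-or-above (height u k) (height u j)
    ... | inj₁ below = below
    ... | inj₂ above with fireable-height u f near
    ...   | o , near-o , sum≤ = 1≰0 (contra (height u j) (height u o) low (grad (near-sym near-o) o-end))
      where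
      low′ : ∀ x y z → y + z + + 2 ≤ x + x → x ≤ z → y + + 2 ≤ x
      low′ x y z p q = p ⊹ q ⊢ solve (x ∷ y ∷ z ∷ [])
      low : height u o + + 2 ≤ height u j
      low = low′ (height u j) (height u o) (height u k) sum≤ above
      contra : ∀ x y → y + + 2 ≤ x → x ≤ y + 1ℤ → 1ℤ ≤ 0ℤ
      contra x y p q = p ⊹ q ⊢ solve (x ∷ y ∷ [])
      end′ : ∀ x X y Y z → y + y + Y + + 2 ≤ x + x + X → Y ≤ X + 1ℤ → x + X ≤ z →
        (y + Y + 1ℤ) + (y + Y + 1ℤ) ≤ z + z + 1ℤ
      end′ x X y Y z p q s = p ⊹ q ⊹ s ⊹ s ⊢ solve (x ∷ X ∷ y ∷ Y ∷ z ∷ [])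
      o-end : InEndgame u o
      o-end = half-≤ _ _ (end′ (u j) (abs j) (u o) (abs o) M low (near-abs near-o) end)

    -- If `k` is in the endgame, this is gradualness seen from `k`; if not, `u k + abs k` is at
    -- least `M`, which is high enough.
    fired-neighbour-above : ∀ u {j k} → Gradual u → Near j k →
      u j + abs j ≤ M → height u j ≤ height u k + 1ℤ
    fired-neighbour-above u {j} {k} grad near end with below-or-above (u k + abs k) M
    ... | inj₁ k-end = grad (near-sym near) k-end
    ... | inj₂ k-out = go (u j) (abs j) (u k) (abs k) M end k-out (near-abs near)
      where
      go : ∀ x X y Y z → x + X ≤ z → z ≤ y + Y → Y ≤ X + 1ℤ → x + x + X ≤ y + y + Y + 1ℤ
      go x X y Y z p q s = p ⊹ p ⊹ q ⊹ q ⊹ s ⊢ solve (x ∷ X ∷ y ∷ Y ∷ z ∷ [])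

    fire-endgame : ∀ u j → InEndgame (fire u j) j → u j + abs j ≤ M
    fire-endgame u j p rewrite fire-at u j = go (u j) (abs j) M p
      where
      go : ∀ x X z → x - 1ℤ + X + 1ℤ ≤ z → x + X ≤ z
      go x X z p = p ⊢ solve (x ∷ X ∷ z ∷ [])

    -- Only the height of `j` drops, by 2. Seen from another site the bound survives; seen from `j`
    -- it requires the neighbours to be strictly lower before the firing.
    fire-gradual : ∀ u {j} → Gradual u → Fireable u j → Gradual (fire u j)
    fire-gradual u {j} grad f {i} {k} near end = by (i ≟ j)
      where
      at : ∀ x X z → z + 1ℤ ≤ x + x + X → z ≤ (x - 1ℤ) + (x - 1ℤ) + X + 1ℤ
      at x X z p = p ⊢ solve (x ∷ X ∷ z ∷ [])
      away : ∀ x y X → x ≤ y → x + x + X ≤ y + y + X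
      away x y X p = p ⊹ p ⊢ solve (x ∷ y ∷ X ∷ [])
      by : Dec (i ≡ j) → height (fire u j) k ≤ height (fire u j) i + 1ℤ
      by (yes refl) =
        subst₂ (λ x y → x + x + abs k ≤ y + y + abs i + 1ℤ)
          (sym (fire-away u (near-≢ near))) (sym (fire-at u i))
          (at (u i) (abs i) (height u k) (fired-neighbour-below u grad f near (fire-endgame u i end)))
      by (no i≢j) =
        subst (λ x → height (fire u j) k ≤ x + x + abs i + 1ℤ) (sym (fire-away u i≢j))
          (≤-trans (away (fire u j k) (u k) (abs k) (fire-≤ u j k))
            (grad near (subst (λ x → x + abs i + 1ℤ ≤ M) (fire-away u i≢j) end)))

    -- A load of 2 before the firing means that the site is left empty.
    endgame-empties : ∀ u {j l k} → Gradual u → Adj l j → Adj j k → u j + abs j ≤ M →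
      load u l j k ≤ + 2
    endgame-empties u {j} {l} {k} grad adj₁ adj₂ end =
      half-≤ _ _ (go (final j - final k) (u j) (u l) (u k) (abs j) (abs l) (abs k) (final-gap adj₁ adj₂)
        (fired-neighbour-above u grad (inj₂ adj₁) end) (fired-neighbour-above u grad (inj₁ adj₂) end))
      where
      go : ∀ d x y z X Y Z → d + d ≤ + 2 + (X + X) - Y - Z → x + x + X ≤ y + y + Y + 1ℤ →
        x + x + X ≤ z + z + Z + 1ℤ → (d + (x + x) - (y + z)) + (d + (x + x) - (y + z)) ≤ + 5
      go d x y z X Y Z p q s = p ⊹ q ⊹ s ⊹ 0≤+ 1 ⊢ solve (d ∷ x ∷ y ∷ z ∷ X ∷ Y ∷ Z ∷ [])

  -- Small chips

  -- N and S stand for the numbers of chips and of small chips at or right of a site.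
  record Counts (K : ℤ) (N S : ℤ → ℤ) : Set where
    field
      bounded : ∀ i → S i ≤ K
      below : ∀ i → S i ≤ N i
      antitone : ∀ i → S (1ℤ + i) ≤ S i
      dominated : ∀ i → S i - S (1ℤ + i) ≤ N i - N (1ℤ + i)

  -- The effect on cumulative counts of moving y chips from j to the left and z chips to the right.
  moved : (ℤ → ℤ) → ℤ → ℤ → ℤ → ℤ → ℤ
  moved f j y z i = f i - κ i j * y + κ i (1ℤ + j) * z

  moved-at : ∀ f j y z → moved f j y z j ≡ f j - y
  moved-at f j y z rewrite κ-refl {j} refl | κ-≢ (λ e → suc≢ j (sym e)) = go (f j)
    where
    go : ∀ x → x - 1ℤ * y + 0ℤ * z ≡ x - y
    go x = solve (x ∷ y ∷ z ∷ [])

  moved-next : ∀ f j y z → moved f j y z (1ℤ + j) ≡ f (1ℤ + j) + z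
  moved-next f j y z rewrite κ-refl {1ℤ + j} refl | κ-≢ (suc≢ j) = go (f (1ℤ + j))
    where
    go : ∀ x → x - 0ℤ * y + 1ℤ * z ≡ x + z
    go x = solve (x ∷ y ∷ z ∷ [])

  moved-away : ∀ f j y z {i} → ¬ i ≡ j → ¬ i ≡ 1ℤ + j → moved f j y z i ≡ f i
  moved-away f j y z {i} i≢j i≢k rewrite κ-≢ i≢j | κ-≢ i≢k = go (f i)
    where
    go : ∀ x → x - 0ℤ * y + 0ℤ * z ≡ x
    go x = solve (x ∷ y ∷ z ∷ [])

  -- `lefts` and `rights` count the small chips in the two bundles. All that is kept of the labels
  -- is `sorted`: a small chip goes right only if the left bundle is entirely small.
  record Move (r : ℤ) (N S N′ S′ : ℤ → ℤ) : Set where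
    field
      site lefts rights : ℤ
      N-move : ∀ i → N′ i ≡ moved N site r r i
      S-move : ∀ i → S′ i ≡ moved S site lefts rights i
      enough : N (1ℤ + site) + (r + r) ≤ N site
      0≤lefts : 0ℤ ≤ lefts
      rights≤r : rights ≤ r
      sorted : rights ≡ 0ℤ ⊎ lefts ≡ r

  record Initial (T K : ℤ) (N S : ℤ → ℤ) : Set where
    field
      N-left : ∀ {i} → i ≤ 0ℤ → N i ≡ T
      S-left : ∀ {i} → i ≤ 0ℤ → S i ≡ K
      N-right : ∀ n → N +[1+ n ] ≡ 0ℤ
      S-right : ∀ n → S +[1+ n ] ≡ 0ℤ

  -- The sorting invariant and its preservation

  module Sorting (m : ℕ) (r : ℤ) {{_ : Positive r}} (K : ℤ) where
    open Profile m
    open Endgame m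

    0≤r : 0ℤ ≤ r
    0≤r = <⇒≤ (positive⁻¹ r)

    -- Let the columns of width r of the sorting network formed by the endgame be numbered by b.
    -- Window u i b says that column b has already passed to the left of i, and Cap that the
    -- chips then at or right of i contain only what does not fit into the first b columns.
    Window : (ℤ → ℤ) → ℤ → ℤ → Set
    Window u i b = b ≤ 0ℤ ⊎ b ≤ i ⊎ (b + u i ≤ M × b + u i ≤ M + i)

    Cap : ℤ → ℤ → Set
    Cap s b = s ≤ 0ℤ ⊎ s + r * b ≤ K

    -- Only `capped` concerns small chips; the other fields describe the unlabeled process through
    -- the firings still to come.
    record Invariant (N S : ℤ → ℤ) : Set where
      field
        remaining : ℤ → ℤ
        nonneg : ∀ i → 0ℤ ≤ remaining i
        outside : ∀ i → M ≤ abs i → remaining i ≤ 0ℤ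
        balance : ∀ {l j} → Adj l j → N j ≡ r * (final j - remaining l + remaining j)
        gradual : Gradual remaining
        capped : ∀ i b → Window remaining i b → Cap (S i) b

    cap-nonPos : ∀ {s b} → s ≤ K → b ≤ 0ℤ → s + r * b ≤ K
    cap-nonPos {s} {b} s≤K b≤0 = s≤K ⊹ *-monoˡ-≤-nonNeg r {{nonNegative 0≤r}} b≤0 ⊢ go s b
      where
      go : ∀ s b → K - (s + r * b) ≡ K + r * 0ℤ - (s + r * b)
      go s b = solve (s ∷ b ∷ r ∷ K ∷ [])

    cap-mono : ∀ {s t b} → s ≤ t → Cap t b → Cap s b
    cap-mono s≤t (inj₁ t≤0) = inj₁ (≤-trans s≤t t≤0)
    cap-mono {b = b} s≤t (inj₂ q) = inj₂ (≤-trans (+-monoˡ-≤ (r * b) s≤t) q)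

    -- Leaving `r` small chips behind pays for one more column.
    cap-suc : ∀ {s t b} → s ≤ t - r → Cap t (b - 1ℤ) → Cap s b
    cap-suc {s} {t} s≤t-r (inj₁ t≤0) = inj₁ (s≤t-r ⊹ t≤0 ⊹ 0≤r ⊢ solve (s ∷ t ∷ r ∷ []))
    cap-suc {s} {t} {b} s≤t-r (inj₂ q) = inj₂ (s≤t-r ⊹ q ⊢ go s t b)
      where
      go : ∀ s t b → K - (s + r * b) ≡ (t - r) + K - (s + (t + r * (b - 1ℤ)))
      go s t b = solve (s ∷ t ∷ b ∷ r ∷ K ∷ [])

    -- If `b` exceeds both 0 and `i`, the window puts `i` in the endgame, so that gradualness
    -- applies: through the bound by `M` if `abs i` is `i`, through the bound by `M + i` if it is
    -- `- i`.
    window-cases : ∀ u i b → Window u i b →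
      b ≤ 0ℤ ⊎ b ≤ i ⊎ (InEndgame u i × b + u i ≤ M × b + u i ≤ M + i)
    window-cases u i b (inj₁ b≤0) = inj₁ b≤0
    window-cases u i b (inj₂ (inj₁ b≤i)) = inj₂ (inj₁ b≤i)
    window-cases u i b (inj₂ (inj₂ (p , q))) with below-or-above 0ℤ b | below-or-above i b
    ... | inj₂ b≤0 | _ = inj₁ b≤0
    ... | inj₁ _ | inj₂ b≤i = inj₂ (inj₁ b≤i)
    ... | inj₁ 0<b | inj₁ i<b = inj₂ (inj₂ (endgame , p , q))
      where
      right : ∀ x i b z → i + 1ℤ ≤ b → b + x ≤ z → x + i + 1ℤ ≤ z
      right x i b z s p = s ⊹ p ⊢ solve (x ∷ i ∷ b ∷ z ∷ [])
      left : ∀ x i b z → 1ℤ ≤ b → b + x ≤ z + i → x + - i + 1ℤ ≤ z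
      left x i b z s q = s ⊹ q ⊢ solve (x ∷ i ∷ b ∷ z ∷ [])
      endgame : InEndgame u i
      endgame with abs-cases i
      ... | inj₁ eq rewrite eq = right (u i) i b M i<b p
      ... | inj₂ eq rewrite eq = left (u i) i b M 0<b q

    -- A step to the left costs one column. Gradualness gives `x ≤ y + 1ℤ` right of the origin and
    -- `x ≤ y` left of it; the bound by `M` is decisive on the right, the one by `M + j` on the
    -- left.
    window-leftwards : ∀ {j k} → Adj j k → ∀ x y b →
      x + x + abs j ≤ y + y + abs k + 1ℤ → b + y ≤ M → b + y ≤ M + k →
      b - 1ℤ + x ≤ M × b - 1ℤ + x ≤ M + j
    window-leftwards {j} adj@next x y b h p q with adj-side adj
    ... | inj₁ (0≤j , e , f) rewrite e | f = first , (first ⊹ 0≤j ⊢ go x j b M)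
      where
      x≤ : ∀ x y j → x + x + j ≤ y + y + (1ℤ + j) + 1ℤ → x ≤ y + 1ℤ
      x≤ x y j h = half-≤ x (y + 1ℤ) (h ⊹ 0≤+ 1 ⊢ solve (x ∷ y ∷ j ∷ []))
      first′ : ∀ x y b z → x ≤ y + 1ℤ → b + y ≤ z → b - 1ℤ + x ≤ z
      first′ x y b z p q = p ⊹ q ⊢ solve (x ∷ y ∷ b ∷ z ∷ [])
      first : b - 1ℤ + x ≤ M
      first = first′ x y b M (x≤ x y j h) p
      go : ∀ x j b z → z + j - (b - 1ℤ + x) ≡ z + j - (b - 1ℤ + x + 0ℤ)
      go x j b z = solve (x ∷ j ∷ b ∷ z ∷ [])
    ... | inj₂ (k≤0 , e , f) rewrite e | f = (second ⊹ k≤0 ⊹ 0≤+ 1 ⊢ go x j b M) , second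
      where
      x≤ : ∀ x y j → x + x + - j ≤ y + y + - (1ℤ + j) + 1ℤ → x ≤ y
      x≤ x y j h = half-≤ x y (h ⊹ 0≤+ 1 ⊢ solve (x ∷ y ∷ j ∷ []))
      second′ : ∀ x y b z j → x ≤ y → b + y ≤ z + (1ℤ + j) → b - 1ℤ + x ≤ z + j
      second′ x y b z j p q = p ⊹ q ⊢ solve (x ∷ y ∷ b ∷ z ∷ j ∷ [])
      second : b - 1ℤ + x ≤ M + j
      second = second′ x y b M j (x≤ x y j h) q
      go : ∀ x j b z → z - (b - 1ℤ + x) ≡ z + j + (0ℤ + 1ℤ) - (b - 1ℤ + x + (1ℤ + j + 0ℤ))
      go x j b z = solve (x ∷ j ∷ b ∷ z ∷ [])

    -- A step to the right keeps the column: the weaker comparison `y ≤ x + 1ℤ` occurs only left of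
    -- the origin, where the bound `M + j` rises to `M + k`.
    window-rightwards : ∀ {j k} → Adj j k → ∀ x y b →
      y + y + abs k ≤ x + x + abs j + 1ℤ → b + x ≤ M → b + x ≤ M + j →
      b + y ≤ M × b + y ≤ M + k
    window-rightwards {j} adj@next x y b h p q with adj-side adj
    ... | inj₁ (0≤j , e , f) rewrite e | f = first , (first ⊹ 0≤j ⊹ 0≤+ 1 ⊢ go y j b M)
      where
      y≤ : ∀ x y j → y + y + (1ℤ + j) ≤ x + x + j + 1ℤ → y ≤ x
      y≤ x y j h = half-≤ y x (h ⊹ 0≤+ 1 ⊢ solve (x ∷ y ∷ j ∷ []))
      first′ : ∀ x y b z → y ≤ x → b + x ≤ z → b + y ≤ z
      first′ x y b z p q = p ⊹ q ⊢ solve (x ∷ y ∷ b ∷ z ∷ [])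
      first : b + y ≤ M
      first = first′ x y b M (y≤ x y j h) p
      go : ∀ y j b z → z + (1ℤ + j) - (b + y) ≡ z + (j + 1ℤ) - (b + y + (0ℤ + 0ℤ))
      go y j b z = solve (y ∷ j ∷ b ∷ z ∷ [])
    ... | inj₂ (k≤0 , e , f) rewrite e | f = (second ⊹ k≤0 ⊢ go y j b M) , second
      where
      y≤ : ∀ x y j → y + y + - (1ℤ + j) ≤ x + x + - j + 1ℤ → y ≤ x + 1ℤ
      y≤ x y j h = half-≤ y (x + 1ℤ) (h ⊹ 0≤+ 1 ⊢ solve (x ∷ y ∷ j ∷ []))
      second′ : ∀ x y b z j → y ≤ x + 1ℤ → b + x ≤ z + j → b + y ≤ z + (1ℤ + j)
      second′ x y b z j p q = p ⊹ q ⊢ solve (x ∷ y ∷ b ∷ z ∷ j ∷ [])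
      second : b + y ≤ M + (1ℤ + j)
      second = second′ x y b M j (y≤ x y j h) q
      go : ∀ y j b z → z - (b + y) ≡ z + (1ℤ + j) + 0ℤ - (b + y + (1ℤ + j))
      go y j b z = solve (y ∷ j ∷ b ∷ z ∷ [])

    balance-gap : ∀ {N S} (inv : Invariant N S) → ∀ {l j k} → Adj l j → Adj j k →
      N j - N k ≡ r * load (Invariant.remaining inv) l j k
    balance-gap inv {l} {j} {k} p q rewrite Invariant.balance inv p | Invariant.balance inv q =
      go (final j) (final k) (remaining l) (remaining j) (remaining k)
      where
      open Invariant inv
      go : ∀ f g x y z → r * (f - x + y) - r * (g - y + z) ≡ r * (f - g + (y + y) - (x + z))
      go f g x y z = solve (f ∷ g ∷ x ∷ y ∷ z ∷ r ∷ [])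

    module Step {N S N′ S′ : ℤ → ℤ}
      (inv : Invariant N S) (counts : Counts K N′ S′) (move : Move r N S N′ S′) where
      open Invariant inv
      open Counts counts
      open Move move

      u u′ : ℤ → ℤ
      u = remaining
      u′ = fire u site

      next-site : ℤ
      next-site = 1ℤ + site

      gap : ∀ {l k} → Adj l site → Adj site k → N site - N k ≡ r * load u l site k
      gap = balance-gap inv

      fireable : Fireable u site
      fireable {l} p q@next = *-cancelˡ-≤-pos (+ 2) (load u l site next-site) r
        (subst (r * + 2 ≤_) (gap p q) (enough ⊢ go (N site) (N next-site)))
        where
        go : ∀ x y → x - y - r * + 2 ≡ x - (y + (r + r))
        go x y = solve (x ∷ y ∷ r ∷ [])

      S′-site : S′ site ≡ S site - lefts
      S′-site = trans (S-move site) (moved-at S site lefts rights)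

      S′-next : S′ next-site ≡ S next-site + rights
      S′-next = trans (S-move next-site) (moved-next S site lefts rights)

      -- The small chips at or right of `next-site` after the firing are among those at or right of
      -- `site` before, less the `r` sent left.
      rights≤ : lefts ≡ r → S′ next-site ≤ S site - r
      rights≤ refl = ≤-trans (antitone site) (≤-reflexive S′-site)

      nonneg′ : ∀ i → 0ℤ ≤ u′ i
      nonneg′ i = by (i ≟ site)
        where
        by : Dec (i ≡ site) → 0ℤ ≤ u′ i
        by (yes refl) = subst (0ℤ ≤_) (sym (fire-at u site))
          (i≤j⇒0≤j-i (fireable-positive u nonneg fireable))
        by (no i≢) = subst (0ℤ ≤_) (sym (fire-away u i≢)) (nonneg i)

      balance′ : ∀ {l j} → Adj l j → N′ j ≡ r * (final j - u′ l + u′ j)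
      balance′ {l} adj@next rewrite N-move (1ℤ + l) | balance adj
        | κ-cong {1ℤ + l} {1ℤ + site} {l} {site} suc-injective (cong λ x → 1ℤ + x) =
        go (final (1ℤ + l)) (u l) (u (1ℤ + l)) (κ (1ℤ + l) site) (κ l site)
        where
        go : ∀ f x y p q → r * (f - x + y) - p * r + q * r ≡ r * (f - (x - q) + (y - p))
        go f x y p q = solve (f ∷ x ∷ y ∷ p ∷ q ∷ r ∷ [])

      -- The firing leaves no chips at the site, hence no small ones, by `dominated`.
      empties : u site + abs site ≤ M → S′ site ≤ S′ next-site
      empties end = go (S′ site) (S′ next-site) (dominated site) N′-gap
        where
        load≤2 : load u (-1ℤ + site) site next-site ≤ + 2
        load≤2 = endgame-empties u gradual (adj-pred site) next end
        go′ : ∀ x y a b → x ≡ a - r → y ≡ b + r → a - b ≤ r * + 2 → x - y ≤ 0ℤ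
        go′ x y a b refl refl p = p ⊢ solve (a ∷ b ∷ r ∷ [])
        N′-gap : N′ site - N′ next-site ≤ 0ℤ
        N′-gap = go′ (N′ site) (N′ next-site) (N site) (N next-site)
          (trans (N-move site) (moved-at N site r r)) (trans (N-move next-site) (moved-next N site r r))
          (subst (_≤ r * + 2) (sym (gap (adj-pred site) next))
            (*-monoˡ-≤-nonNeg r {{nonNegative 0≤r}} load≤2))
        go : ∀ s t {z} → s - t ≤ z → z ≤ 0ℤ → s ≤ t
        go s t p q = i-j≤0⇒i≤j (≤-trans p q)

      b-1+u≤ : ∀ b x z → b + (x - 1ℤ) ≤ z → b - 1ℤ + x ≤ z
      b-1+u≤ b x z p = p ⊢ solve (b ∷ x ∷ z ∷ [])

      b-1≤ : ∀ b j → b ≤ 1ℤ + j → b - 1ℤ ≤ j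
      b-1≤ b j p = p ⊢ solve (b ∷ j ∷ [])

      -- In the endgame the firing acts as a comparator. If the left bundle is all small, the cap of
      -- column `b - 1ℤ` becomes that of `b`. Otherwise no small chip goes right and the site is
      -- emptied, so the unchanged cap of column `b` at `next-site` carries over.
      capped-site : ∀ b → Window u′ site b → Cap (S′ site) b
      capped-site b w with window-cases u′ site b w
      ... | inj₁ b≤0 = inj₂ (cap-nonPos (bounded site) b≤0)
      ... | inj₂ (inj₁ b≤i) = cap-mono (≤-trans (≤-reflexive S′-site) S-lefts≤S)
        (capped site b (inj₂ (inj₁ b≤i)))
        where
        go : ∀ x y → 0ℤ ≤ y → x - y ≤ x
        go x y p = p ⊢ solve (x ∷ y ∷ [])
        S-lefts≤S : S site - lefts ≤ S site
        S-lefts≤S = go (S site) lefts 0≤lefts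
      ... | inj₂ (inj₂ (end , p , q)) with sorted
      ...   | inj₂ refl = cap-suc (≤-reflexive S′-site) (capped site (b - 1ℤ) (inj₂ (inj₂ (p′ , q′))))
        where
        p′ = b-1+u≤ b (u site) M (subst (λ x → b + x ≤ M) (fire-at u site) p)
        q′ = b-1+u≤ b (u site) (M + site) (subst (λ x → b + x ≤ M + site) (fire-at u site) q)
      ...   | inj₁ refl = cap-mono S′≤S (capped next-site b (inj₂ (inj₂
        (window-rightwards next (u′ site) (u next-site) b h p q))))
        where
        S′≤S : S′ site ≤ S next-site
        S′≤S = ≤-trans (empties (fire-endgame u site end))
          (≤-reflexive (trans S′-next (+-identityʳ (S next-site))))
        h : height u next-site ≤ height u′ site + 1ℤ
        h = subst (λ x → x + x + abs next-site ≤ height u′ site + 1ℤ) (fire-away u (suc≢ site))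
              (fire-gradual u gradual fireable (inj₁ next) end)

      -- Either no small chip arrives, or `r` small chips went left and the cap of column `b - 1ℤ`
      -- at `site` applies through `rights≤`.
      capped-next : ∀ b → Window u next-site b → Cap (S′ next-site) b
      capped-next b w with sorted
      ... | inj₁ refl = cap-mono (≤-reflexive (trans S′-next (+-identityʳ (S next-site)))) (capped next-site b w)
      ... | inj₂ refl with window-cases u next-site b w
      ...   | inj₁ b≤0 = inj₂ (cap-nonPos (bounded next-site) b≤0)
      ...   | inj₂ (inj₁ b≤k) = cap-suc (rights≤ refl)
        (capped site (b - 1ℤ) (inj₂ (inj₁ (b-1≤ b site b≤k))))
      ...   | inj₂ (inj₂ (end , p , q)) = cap-suc (rights≤ refl) (capped site (b - 1ℤ) (inj₂ (inj₂
        (window-leftwards next (u site) (u next-site) b (gradual (inj₂ next) end) p q))))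

      capped′ : ∀ i b → Window u′ i b → Cap (S′ i) b
      capped′ i b w = by (i ≟ site) (i ≟ next-site)
        where
        by : Dec (i ≡ site) → Dec (i ≡ next-site) → Cap (S′ i) b
        by (yes refl) _ = capped-site b w
        by (no i≢) (yes refl) =
          capped-next b (subst (λ x → b ≤ 0ℤ ⊎ b ≤ i ⊎ (b + x ≤ M × b + x ≤ M + i)) (fire-away u i≢) w)
        by (no i≢) (no i≢′) =
          cap-mono (≤-reflexive (trans (S-move i) (moved-away S site lefts rights i≢ i≢′)))
            (capped i b (subst (λ x → b ≤ 0ℤ ⊎ b ≤ i ⊎ (b + x ≤ M × b + x ≤ M + i)) (fire-away u i≢) w))

      preserved : Invariant N′ S′
      preserved = record
        { remaining = u′
        ; nonneg = nonneg′
        ; outside = λ i p → ≤-trans (fire-≤ u site i) (outside i p)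
        ; balance = balance′
        ; gradual = fire-gradual u gradual fireable
        ; capped = capped′
        }

    abs-nonPos : ∀ {i} → i ≤ 0ℤ → abs i ≡ - i
    abs-nonPos {+ .0} (+≤+ ℕ.z≤n) = refl
    abs-nonPos { -[1+ n ]} _ = refl

    initially : ∀ {N S} → Counts K N S → Initial (r * (M + M)) K N S → Invariant N S
    initially {N} {S} counts init = record
      { remaining = odometer
      ; nonneg = λ i → 0≤+ _
      ; outside = odometer-outside
      ; balance = balance
      ; gradual = initially-gradual
      ; capped = capped
      }
      where
      open Counts counts
      open Initial init
      balance-left : ∀ {l j} → Adj l j → j ≤ 0ℤ → N j ≡ r * (final j - odometer l + odometer j)
      balance-left adj j≤0 = trans (N-left j≤0) (cong (r *_) (final-left j≤0 adj))
      balance : ∀ {l j} → Adj l j → N j ≡ r * (final j - odometer l + odometer j)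
      balance {j = +[1+ n ]} adj = trans (N-right n) (trans (sym (*-zeroʳ r)) (cong (r *_) (final-right n adj)))
      balance {j = +0} adj = balance-left adj ≤-refl
      balance {j = -[1+ n ]} adj = balance-left adj -≤+

      -- Here `odometer i` is at least `M + i`, so only windows with nonpositive `b` are open at the
      -- start.
      trivial : ∀ {i b} → i ≤ 0ℤ → Window odometer i b → b ≤ 0ℤ
      trivial i≤0 (inj₁ b≤0) = b≤0
      trivial i≤0 (inj₂ (inj₁ b≤i)) = ≤-trans b≤i i≤0
      trivial {i} {b} i≤0 (inj₂ (inj₂ (_ , q))) =
        go b (odometer i) i M q (subst (λ x → M ≤ odometer i + x) (abs-nonPos i≤0) (odometer-lower i))
        where
        go : ∀ b x i z → b + x ≤ z + i → z ≤ x + - i → b ≤ 0ℤ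
        go b x i z p q = p ⊹ q ⊢ solve (b ∷ x ∷ i ∷ z ∷ [])
      capped : ∀ i b → Window odometer i b → Cap (S i) b
      capped +[1+ n ] b _ = inj₁ (≤-reflexive (S-right n))
      capped +0 b w = inj₂ (cap-nonPos (bounded +0) (trivial ≤-refl w))
      capped -[1+ n ] b w = inj₂ (cap-nonPos (bounded -[1+ n ]) (trivial -≤+ w))

  -- Stable configurations

  Stable : ℤ → (ℤ → ℤ) → Set
  Stable r N = ∀ i → N i < N (1ℤ + i) + (r + r)

  -- A convex sequence that does not decrease at `k` does not decrease from there to `m`, where it
  -- is nonpositive.
  convex-climb : ∀ m (a : ℕ → ℤ) →
    (∀ {k} → k ℕ.< m → a (ℕ.suc k) + a (ℕ.suc k) ≤ a k + a (ℕ.suc (ℕ.suc k))) → a m ≤ 0ℤ →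
    ∀ l {k} → k ℕ.+ l ≡ m → a k ≤ a (ℕ.suc k) → a k ≤ 0ℤ
  convex-climb m a convex end ℕ.zero {k} eq _ = subst (λ x → a x ≤ 0ℤ) (trans (sym eq) (ℕ.+-identityʳ k)) end
  convex-climb m a convex end (ℕ.suc l) {k} eq up =
    ≤-trans up (convex-climb m a convex end l eq′ (go (a k) (a (ℕ.suc k)) (a (ℕ.suc (ℕ.suc k))) up (convex k<m)))
    where
    eq′ : ℕ.suc k ℕ.+ l ≡ m
    eq′ = trans (sym (ℕ.+-suc k l)) eq
    k<m : k ℕ.< m
    k<m = subst (ℕ.suc k ℕ.≤_) eq′ (ℕ.m≤m+n (ℕ.suc k) l)
    go : ∀ x y z → x ≤ y → y + y ≤ x + z → y ≤ z
    go x y z p q = p ⊹ q ⊢ solve (x ∷ y ∷ z ∷ [])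

  convex-nonPos : ∀ m (a : ℕ → ℤ) →
    (∀ {k} → k ℕ.< m → a (ℕ.suc k) + a (ℕ.suc k) ≤ a k + a (ℕ.suc (ℕ.suc k))) → a m ≤ 0ℤ →
    a 0 ≤ 0ℤ → ∀ {k} → k ℕ.≤ m → a k ≤ 0ℤ
  convex-nonPos m a convex end start {ℕ.zero} _ = start
  convex-nonPos m a convex end start {ℕ.suc k} k<m with ≤-total (a (ℕ.suc k)) (a k)
  ... | inj₁ down = ≤-trans down (convex-nonPos m a convex end start (ℕ.<⇒≤ k<m))
  ... | inj₂ up = convex-climb m a convex end (m ℕ.∸ ℕ.suc k) (ℕ.m+[n∸m]≡n k<m)
    (go (a k) (a (ℕ.suc k)) (a (ℕ.suc (ℕ.suc k))) up (convex k<m))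
    where
    go : ∀ x y z → x ≤ y → y + y ≤ x + z → y ≤ z
    go x y z p q = p ⊹ q ⊢ solve (x ∷ y ∷ z ∷ [])

  module FinalState (m : ℕ) where
    open Profile m
    open Endgame m

    final-neg : ∀ k → final (- + k) ≡ M + M - + (m ℕ.∸ k)
    final-neg ℕ.zero = go M
      where
      go : ∀ x → x ≡ x + x - x
      go x = solve (x ∷ [])
    final-neg (ℕ.suc k) = refl

    adj-neg : ∀ k → Adj (- + ℕ.suc k) (- + k)
    adj-neg ℕ.zero = next
    adj-neg (ℕ.suc k) = next

    M+M-final : ∀ n → M + M - final -[1+ n ] ≡ + (m ℕ.∸ ℕ.suc n)
    M+M-final n = go M (+ (m ℕ.∸ ℕ.suc n))
      where
      go : ∀ x y → x + x - (x + x - y) ≡ y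
      go x y = solve (x ∷ y ∷ [])

    -- `M + M - final i` is the number of bundles left of `i` in the end; with it as `b` and no
    -- firings to come, the window at `i` is open.
    final-window : ∀ {i} → i ≤ 0ℤ →
      M + M - final i ≤ 0ℤ ⊎ (M + M - final i ≤ M × M + M - final i ≤ M + i)
    final-window {+ .0} (+≤+ ℕ.z≤n) = inj₂ (≤-reflexive (go M) , ≤-reflexive (go′ M))
      where
      go : ∀ x → x + x - x ≡ x
      go x = solve (x ∷ [])
      go′ : ∀ x → x + x - x ≡ x + 0ℤ
      go′ x = solve (x ∷ [])
    final-window { -[1+ n ]} _ with ℕ.≤-total (ℕ.suc n) m
    ... | inj₁ n<m = inj₂
      ( subst (_≤ M) (sym (M+M-final n)) (+≤+ (ℕ.m∸n≤m m (ℕ.suc n)))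
      , ≤-reflexive (trans (M+M-final n) (sym (⊖-≥ n<m))))
    ... | inj₂ m≤n = inj₁ (≤-reflexive (trans (M+M-final n) (cong +_ (ℕ.m≤n⇒m∸n≡0 m≤n))))

    module _ (u : ℤ → ℤ) (outside : ∀ i → M ≤ abs i → u i ≤ 0ℤ)
      (light : ∀ {l j k} → Adj l j → Adj j k → load u l j k ≤ 1ℤ) where

      private
        convex : ∀ f g x y z → f ≡ g + 1ℤ → f - g + (y + y) - (x + z) ≤ 1ℤ → y + y ≤ x + z
        convex f g x y z refl p = p ⊢ solve (g ∷ x ∷ y ∷ z ∷ [])

      -- The final load is 1 at distances 1 to `m`, so a load of at most 1 makes the remaining
      -- firings convex there.
      right-convex : ∀ {k} → k ℕ.< m → u (+ ℕ.suc k) + u (+ ℕ.suc k) ≤ u (+ k) + u (+ ℕ.suc (ℕ.suc k))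
      right-convex {k} k<m = convex (final (+ ℕ.suc k)) (final (+ ℕ.suc (ℕ.suc k)))
        (u (+ k)) (u (+ ℕ.suc k)) (u (+ ℕ.suc (ℕ.suc k)))
        (sym (∸-drop-< k<m)) (light {+ k} next next)

      left-convex : ∀ {k} → k ℕ.< m →
        u (- + ℕ.suc k) + u (- + ℕ.suc k) ≤ u (- + k) + u (- + ℕ.suc (ℕ.suc k))
      left-convex {k} k<m = subst (u (- + ℕ.suc k) + u (- + ℕ.suc k) ≤_)
        (+-comm (u (- + ℕ.suc (ℕ.suc k))) (u (- + k)))
        (convex (final (- + ℕ.suc k)) (final (- + k))
          (u (- + ℕ.suc (ℕ.suc k))) (u (- + ℕ.suc k)) (u (- + k)) gap (light (adj-neg (ℕ.suc k)) (adj-neg k)))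
        where
        go : ∀ z x y → y + 1ℤ ≡ x → z + z - y ≡ z + z - x + 1ℤ
        go z _ y refl = solve (z ∷ y ∷ [])
        gap : final (- + ℕ.suc k) ≡ final (- + k) + 1ℤ
        gap rewrite final-neg k = go M (+ (m ℕ.∸ k)) (+ (m ℕ.∸ ℕ.suc k)) (∸-drop-< k<m)

      left-end : ∀ k → k ≡ m → u (- + k) ≤ 0ℤ
      left-end ℕ.zero refl = outside 0ℤ ≤-refl
      left-end (ℕ.suc k) refl = outside -[1+ k ] ≤-refl

      centre : u 0ℤ ≤ 0ℤ
      -- The final load of the origin is 0, so lightness leaves a spare 1. A strict drop of `u` to
      -- the right absorbs it, and then `u` does not drop to the left.
      centre with below-or-above (u 1ℤ) (u 0ℤ)
      ... | inj₂ up = convex-climb m (λ k → u (+ k)) right-convex (outside (+ m) ≤-refl) m refl up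
      ... | inj₁ down = convex-climb m (λ k → u (- + k)) left-convex (left-end m refl) m refl
        (go M (u -1ℤ) (u 0ℤ) (u 1ℤ) (light (adj-neg 0) next) down)
        where
        go : ∀ f x y z → f - f + (y + y) - (x + z) ≤ 1ℤ → z + 1ℤ ≤ y → y ≤ x
        go f x y z p q = p ⊹ q ⊢ solve (f ∷ x ∷ y ∷ z ∷ [])

      exhausted : ∀ i → u i ≤ 0ℤ
      exhausted i with ≤-total M (abs i)
      ... | inj₁ out = outside i out
      exhausted (+ n) | inj₂ (+≤+ n≤m) =
        convex-nonPos m (λ k → u (+ k)) right-convex (outside (+ m) ≤-refl) centre n≤m
      exhausted -[1+ n ] | inj₂ (+≤+ n≤m) =
        convex-nonPos m (λ k → u (- + k)) left-convex (left-end m refl) centre n≤m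

    module _ {r : ℤ} {{_ : Positive r}} {K : ℤ} {N S : ℤ → ℤ} 
      (inv : Sorting.Invariant m r K N S) (counts : Counts K N S)
      (stable : Stable r N) (K≤rm : K ≤ r * M) where
      open Sorting m r K
      open Invariant inv
      open Counts counts

      light : ∀ {l j k} → Adj l j → Adj j k → load remaining l j k ≤ 1ℤ
      light {l} {j} p q@next = i<j⇒i≤pred[j] (*-cancelˡ-<-nonNeg r {{nonNegative 0≤r}}
        (subst₂ _<_ (balance-gap inv p q) (go (N (1ℤ + j))) (+-monoˡ-< (- N (1ℤ + j)) (stable j))))
        where
        go : ∀ x → x + (r + r) - x ≡ r * + 2
        go x = solve (x ∷ r ∷ [])

      all-zero : ∀ i → remaining i ≡ 0ℤ
      all-zero i = ≤-antisym (exhausted remaining outside light i) (nonneg i)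

      -- The cap of column `M` leaves no room for a small chip, because `K ≤ r * M`; securing this
      -- bound is the purpose of the reflection.
      right-of-origin : ∀ {i} → 0ℤ ≤ i → 1ℤ ≤ S i → ⊥
      right-of-origin {i} 0≤i 1≤S = 1≰0 (go (capped i M (inj₂ (inj₂ window))))
        where
        window : M + remaining i ≤ M × M + remaining i ≤ M + i
        window = subst (λ x → M + x ≤ M × M + x ≤ M + i) (sym (all-zero i))
          (≤-reflexive (+-identityʳ M) , +-monoʳ-≤ M 0≤i)
        arith : ∀ s z → 1ℤ ≤ s → s + r * z ≤ K → K ≤ r * z → 1ℤ ≤ 0ℤ
        arith s z p q t = p ⊹ q ⊹ t ⊢ solve (s ∷ z ∷ r ∷ K ∷ [])
        go : Cap (S i) M → 1ℤ ≤ 0ℤ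
        go (inj₁ S≤0) = ≤-trans 1≤S S≤0
        go (inj₂ S+rM≤K) = arith (S i) M 1≤S S+rM≤K K≤rm

      -- The cap bounds the number of chips left of `i` by that of the small ones there, whereas
      -- `larger` puts a large chip left of `i`.
      left-of-origin : ∀ {i} → i ≤ 0ℤ → 1ℤ ≤ S i → N i - S i + 1ℤ ≤ r * (M + M) - K → ⊥
      left-of-origin {i} i≤0 1≤S larger = 1≰0 (go (capped i (M + M - final i) window))
        where
        window : Window remaining i (M + M - final i)
        window = subst (λ x → M + M - final i ≤ 0ℤ ⊎ M + M - final i ≤ i ⊎ (x ≤ M × x ≤ M + i))
          (sym (trans (cong (λ x → M + M - final i + x) (all-zero i)) (+-identityʳ (M + M - final i))))
          (map₂ inj₂ (final-window i≤0))
        N-final : N i ≡ r * (final i - 0ℤ + 0ℤ)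
        N-final = trans (balance (adj-pred i))
          (cong₂ (λ x y → r * (final i - x + y)) (all-zero (-1ℤ + i)) (all-zero i))
        arith : ∀ s z n f → n ≡ r * (f - 0ℤ + 0ℤ) → n - s + 1ℤ ≤ r * (z + z) - K →
          s + r * (z + z - f) ≤ K → 1ℤ ≤ 0ℤ
        arith s z _ f refl p q = p ⊹ q ⊢ solve (s ∷ z ∷ f ∷ r ∷ K ∷ [])
        go : Cap (S i) (M + M - final i) → 1ℤ ≤ 0ℤ
        go (inj₁ S≤0) = ≤-trans 1≤S S≤0
        go (inj₂ S≤) = arith (S i) M (N i) (final i) N-final larger S≤

      no-inversion : ∀ i → 1ℤ ≤ S i → N i - S i + 1ℤ ≤ r * (M + M) - K → ⊥
      no-inversion i 1≤S larger with ≤-total 0ℤ i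
      ... | inj₁ 0≤i = right-of-origin 0≤i 1≤S
      ... | inj₂ i≤0 = left-of-origin i≤0 1≤S larger

  -- Reflecting the line through the origin and exchanging small with large chips.
  module Reflection (T K : ℤ) where

    -- A chip at or right of `i` after reflection was at or left of `- i`, so it is one of those not
    -- counted at `1ℤ - i`.
    reflectN : (ℤ → ℤ) → ℤ → ℤ
    reflectN N i = T - N (1ℤ - i)

    reflectS : (ℤ → ℤ) → (ℤ → ℤ) → ℤ → ℤ
    reflectS N S i = T - K - (N (1ℤ - i) - S (1ℤ - i))

    1-suc : ∀ i → 1ℤ - (1ℤ + i) ≡ - i
    1-suc i = solve (i ∷ [])

    -- Reflection exchanges `bounded` with `below` and `antitone` with `dominated`.
    reflect-counts : ∀ {N S} → Counts K N S → Counts (T - K) (reflectN N) (reflectS N S)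
    reflect-counts {N} {S} counts = record
      { bounded = λ i → bounded′ (N (1ℤ - i)) (S (1ℤ - i)) (below (1ℤ - i))
      ; below = λ i → below′ (N (1ℤ - i)) (S (1ℤ - i)) (bounded (1ℤ - i))
      ; antitone = antitone′
      ; dominated = dominated′
      }
      where
      open Counts counts
      bounded′ : ∀ n s → s ≤ n → T - K - (n - s) ≤ T - K
      bounded′ n s p = p ⊢ solve (n ∷ s ∷ T ∷ K ∷ [])
      below′ : ∀ n s → s ≤ K → T - K - (n - s) ≤ T - n
      below′ n s p = p ⊢ solve (n ∷ s ∷ T ∷ K ∷ [])
      antitone′ : ∀ i → reflectS N S (1ℤ + i) ≤ reflectS N S i
      antitone′ i rewrite 1-suc i = go (N (- i)) (S (- i)) (N (1ℤ - i)) (S (1ℤ - i)) (dominated (- i))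
        where
        go : ∀ n s n′ s′ → s - s′ ≤ n - n′ → T - K - (n - s) ≤ T - K - (n′ - s′)
        go n s n′ s′ p = p ⊢ solve (n ∷ s ∷ n′ ∷ s′ ∷ T ∷ K ∷ [])
      dominated′ : ∀ i → reflectS N S i - reflectS N S (1ℤ + i) ≤ reflectN N i - reflectN N (1ℤ + i)
      dominated′ i rewrite 1-suc i = go (N (- i)) (S (- i)) (N (1ℤ - i)) (S (1ℤ - i)) (antitone (- i))
        where
        go : ∀ n s n′ s′ → s′ ≤ s →
          T - K - (n′ - s′) - (T - K - (n - s)) ≤ T - n′ - (T - n)
        go n s n′ s′ p = p ⊢ solve (n ∷ s ∷ n′ ∷ s′ ∷ T ∷ K ∷ [])

    reflect-initial : ∀ {N S} → Initial T K N S → Initial T (T - K) (reflectN N) (reflectS N S)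
    reflect-initial {N} {S} init = record
      { N-left = N-left′ ; S-left = S-left′ ; N-right = N-right′ ; S-right = S-right′ }
      where
      open Initial init
      at-left : ∀ n → 1ℤ - +[1+ n ] ≤ 0ℤ
      at-left ℕ.zero = ≤-refl
      at-left (ℕ.suc n) = -≤+
      N-left′ : ∀ {i} → i ≤ 0ℤ → reflectN N i ≡ T
      N-left′ {+ .0} (+≤+ ℕ.z≤n) rewrite N-right 0 = +-identityʳ T
      N-left′ { -[1+ n ]} _ rewrite N-right (ℕ.suc n) = +-identityʳ T
      S-left′ : ∀ {i} → i ≤ 0ℤ → reflectS N S i ≡ T - K
      S-left′ {+ .0} (+≤+ ℕ.z≤n) rewrite N-right 0 | S-right 0 = +-identityʳ (T - K)
      S-left′ { -[1+ n ]} _ rewrite N-right (ℕ.suc n) | S-right (ℕ.suc n) = +-identityʳ (T - K)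
      N-right′ : ∀ n → reflectN N +[1+ n ] ≡ 0ℤ
      N-right′ n rewrite N-left (at-left n) = +-inverseʳ T
      S-right′ : ∀ n → reflectS N S +[1+ n ] ≡ 0ℤ
      S-right′ n rewrite N-left (at-left n) | S-left (at-left n) = +-inverseʳ (T - K)

    κ-next-reflect : ∀ i j → κ (1ℤ - i) (1ℤ + j) ≡ κ i (- j)
    κ-next-reflect i j = κ-cong
      (λ p → trans (sym (neg-involutive i)) (cong -_ (suc-injective p)))
      (λ p → cong (λ x → 1ℤ + x) (trans (cong -_ p) (neg-involutive j)))

    κ-reflect : ∀ i j → κ (1ℤ - i) j ≡ κ i (1ℤ - j)
    κ-reflect i j = κ-cong {1ℤ - i} {j} {i} {1ℤ - j}
      (λ { refl → solve (i ∷ []) }) (λ { refl → solve (j ∷ []) })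

    reflect-move : ∀ {r N S N′ S′} → Move r N S N′ S′ →
      Move r (reflectN N) (reflectS N S) (reflectN N′) (reflectS N′ S′)
    reflect-move {r} {N} {S} {N′} {S′} move = record
      { site = - site
      -- The new left bundle is the old right one, and its small chips are the formerly large ones;
      -- the two cases of `sorted` trade places.
      ; lefts = r - rights
      ; rights = r - lefts
      ; N-move = N-move′
      ; S-move = S-move′
      ; enough = enough′
      ; 0≤lefts = i≤j⇒0≤j-i rights≤r
      ; rights≤r = rights≤r′ lefts 0≤lefts
      ; sorted = sorted′ sorted
      }
      where
      open Move move
      N-move′ : ∀ i → reflectN N′ i ≡ moved (reflectN N) (- site) r r i
      N-move′ i rewrite N-move (1ℤ - i) | κ-next-reflect i site | κ-reflect i site =
        go (N (1ℤ - i)) (κ i (- site)) (κ i (1ℤ - site))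
        where
        go : ∀ n p q → T - (n - q * r + p * r) ≡ T - n - p * r + q * r
        go n p q = solve (n ∷ p ∷ q ∷ r ∷ T ∷ [])
      S-move′ : ∀ i → reflectS N′ S′ i ≡ moved (reflectS N S) (- site) (r - rights) (r - lefts) i
      S-move′ i rewrite N-move (1ℤ - i) | S-move (1ℤ - i) | κ-next-reflect i site | κ-reflect i site =
        go (N (1ℤ - i)) (S (1ℤ - i)) (κ i (- site)) (κ i (1ℤ - site)) lefts rights
        where
        go : ∀ n s p q x y → T - K - (n - q * r + p * r - (s - q * x + p * y)) ≡
          T - K - (n - s) - p * (r - y) + q * (r - x)
        go n s p q x y = solve (n ∷ s ∷ p ∷ q ∷ x ∷ y ∷ r ∷ T ∷ K ∷ [])
      enough′ : reflectN N (1ℤ + - site) + (r + r) ≤ reflectN N (- site)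
      enough′ rewrite 1-suc (- site) | neg-involutive site = go (N site) (N (1ℤ + site)) enough
        where
        go : ∀ x y → y + (r + r) ≤ x → T - x + (r + r) ≤ T - y
        go x y p = p ⊢ solve (x ∷ y ∷ r ∷ T ∷ [])
      rights≤r′ : ∀ x → 0ℤ ≤ x → r - x ≤ r
      rights≤r′ x p = p ⊢ solve (x ∷ r ∷ [])
      sorted′ : rights ≡ 0ℤ ⊎ lefts ≡ r → r - lefts ≡ 0ℤ ⊎ r - rights ≡ r
      sorted′ (inj₁ refl) = inj₂ (+-identityʳ r)
      sorted′ (inj₂ refl) = inj₁ (+-inverseʳ r)

    reflect-stable : ∀ {r N} → Stable r N → Stable r (reflectN N)
    reflect-stable {r} {N} stable i rewrite 1-suc i =
      go (N (- i)) (N (1ℤ - i)) (stable (- i))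
      where
      go : ∀ x y → x < y + (r + r) → T - y < T - x + (r + r)
      go x y p = suc[i]≤j⇒i<j (i<j⇒suc[i]≤j p ⊢ go′)
        where
        go′ : T - x + (r + r) - (1ℤ + (T - y)) ≡ y + (r + r) - (1ℤ + x)
        go′ = solve (x ∷ y ∷ r ∷ T ∷ [])

  -- Counting chips

  sum : ∀ {n} → (Fin n → ℤ) → ℤ
  sum = Vector.foldr _+_ 0ℤ

  sum-mono : ∀ {n} (f g : Fin n → ℤ) → (∀ a → f a ≤ g a) → sum f ≤ sum g
  sum-mono {ℕ.zero} f g f≤g = ≤-refl
  sum-mono {ℕ.suc n} f g f≤g = +-mono-≤ (f≤g zero) (sum-mono (f ∘ suc) (g ∘ suc) (f≤g ∘ suc))

  sum-nonneg : ∀ {n} (f : Fin n → ℤ) → (∀ a → 0ℤ ≤ f a) → 0ℤ ≤ sum f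
  sum-nonneg {ℕ.zero} f 0≤f = ≤-refl
  sum-nonneg {ℕ.suc n} f 0≤f = +-mono-≤ (0≤f zero) (sum-nonneg (f ∘ suc) (0≤f ∘ suc))

  term≤sum : ∀ {n} (f : Fin n → ℤ) → (∀ a → 0ℤ ≤ f a) → ∀ a → f a ≤ sum f
  term≤sum f 0≤f zero = subst (_≤ sum f) (+-identityʳ (f zero))
    (+-monoʳ-≤ (f zero) (sum-nonneg (f ∘ suc) (0≤f ∘ suc)))
  term≤sum f 0≤f (suc a) = subst (_≤ sum f) (+-identityˡ (f (suc a)))
    (+-mono-≤ (0≤f zero) (term≤sum (f ∘ suc) (0≤f ∘ suc) a))

  sum-cong : ∀ {n} (f g : Fin n → ℤ) → (∀ a → f a ≡ g a) → sum f ≡ sum g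
  sum-cong {ℕ.zero} f g f≡g = refl
  sum-cong {ℕ.suc n} f g f≡g = cong₂ _+_ (f≡g zero) (sum-cong (f ∘ suc) (g ∘ suc) (f≡g ∘ suc))

  sum-zero : ∀ {n} (f : Fin n → ℤ) → (∀ a → f a ≡ 0ℤ) → sum f ≡ 0ℤ
  sum-zero {ℕ.zero} f f≡0 = refl
  sum-zero {ℕ.suc n} f f≡0 = cong₂ _+_ (f≡0 zero) (sum-zero (f ∘ suc) (f≡0 ∘ suc))

  sum-ones : ∀ n → sum {n} (λ _ → 1ℤ) ≡ + n
  sum-ones ℕ.zero = refl
  sum-ones (ℕ.suc n) = cong (λ x → 1ℤ + x) (sum-ones n)

  sum-+ : ∀ {n} (f g : Fin n → ℤ) → sum (λ a → f a + g a) ≡ sum f + sum g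
  sum-+ {ℕ.zero} f g = refl
  sum-+ {ℕ.suc n} f g = trans (cong (λ s → f zero + g zero + s) (sum-+ (f ∘ suc) (g ∘ suc)))
    (go (f zero) (g zero) (sum (f ∘ suc)) (sum (g ∘ suc)))
    where
    go : ∀ x y s t → x + y + (s + t) ≡ x + s + (y + t)
    go x y s t = solve (x ∷ y ∷ s ∷ t ∷ [])

  sum-difference : ∀ {n} (f g : Fin n → ℤ) → sum (λ a → f a - g a) ≡ sum f - sum g
  sum-difference {ℕ.zero} f g = refl
  sum-difference {ℕ.suc n} f g = trans (cong (λ s → f zero - g zero + s) (sum-difference (f ∘ suc) (g ∘ suc)))
    (go (f zero) (g zero) (sum (f ∘ suc)) (sum (g ∘ suc)))
    where
    go : ∀ x y s t → x - y + (s - t) ≡ x + s - (y + t)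
    go x y s t = solve (x ∷ y ∷ s ∷ t ∷ [])

  sum-scale : ∀ {n} x (f : Fin n → ℤ) → sum (λ a → x * f a) ≡ x * sum f
  sum-scale {ℕ.zero} x f = sym (*-zeroʳ x)
  sum-scale {ℕ.suc n} x f = trans (cong (λ s → x * f zero + s) (sum-scale x (f ∘ suc)))
    (sym (*-distribˡ-+ x (f zero) (sum (f ∘ suc))))

  sum-linear : ∀ {n} (f g h : Fin n → ℤ) x y →
    sum (λ a → f a - x * g a + y * h a) ≡ sum f - x * sum g + y * sum h
  sum-linear f g h x y = trans (sum-+ (λ a → f a - x * g a) (λ a → y * h a))
    (cong₂ _+_
      (trans (sum-difference f (λ a → x * g a)) (cong (λ s → sum f - s) (sum-scale x g)))
      (sum-scale y h))

  χ : ∀ {n} → Subset n → Fin n → ℤ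
  χ X a = if lookup X a then 1ℤ else 0ℤ

  χ-∈ : ∀ {n} {X : Subset n} {a} → a ∈ X → χ X a ≡ 1ℤ
  χ-∈ a∈X rewrite []=⇒lookup a∈X = refl

  χ-∉ : ∀ {n} {X : Subset n} {a} → a ∉ X → χ X a ≡ 0ℤ
  χ-∉ {X = X} {a} a∉X with lookup X a in eq
  ... | true = contradiction (lookup⇒[]= a X eq) a∉X
  ... | false = refl

  sum-χ : ∀ {n} (X : Subset n) → sum (χ X) ≡ + size X
  sum-χ Vec.[] = refl
  sum-χ (true Vec.∷ X) = cong (λ x → 1ℤ + x) (sum-χ X)
  sum-χ (false Vec.∷ X) = trans (+-identityˡ _) (sum-χ X)

  sum-χ-one : ∀ {n} (X : Subset n) → sum (λ a → 1ℤ * χ X a) ≡ + size X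
  sum-χ-one X = trans (sum-cong _ _ λ a → *-identityˡ (χ X a)) (sum-χ X)

  θ : ℤ → ℤ → ℤ
  θ i x = if does (i ≤? x) then 1ℤ else 0ℤ

  θ-≤ : ∀ {i x} → i ≤ x → θ i x ≡ 1ℤ
  θ-≤ {i} {x} p rewrite dec-true (i ≤? x) p = refl

  θ-≰ : ∀ {i x} → ¬ i ≤ x → θ i x ≡ 0ℤ
  θ-≰ {i} {x} p rewrite dec-false (i ≤? x) p = refl

  suc-≤ : ∀ {i j} → i ≤ j → 1ℤ + i ≤ 1ℤ + j
  suc-≤ = +-monoʳ-≤ 1ℤ

  suc-cancel-≤ : ∀ {i j} → 1ℤ + i ≤ 1ℤ + j → i ≤ j
  suc-cancel-≤ {i} {j} p = p ⊢ solve (i ∷ j ∷ [])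

  θ-shift : ∀ i x → θ (1ℤ + i) (1ℤ + x) ≡ θ i x
  θ-shift i x with i ≤? x
  ... | yes p = θ-≤ (suc-≤ p)
  ... | no ¬p = θ-≰ (¬p ∘ suc-cancel-≤)

  θ-suc : ∀ i x → θ i (1ℤ + x) ≡ θ i x + κ i (1ℤ + x)
  θ-suc i x = by (i ≤? x) (i ≟ 1ℤ + x)
    where
    by : Dec (i ≤ x) → Dec (i ≡ 1ℤ + x) → θ i (1ℤ + x) ≡ θ i x + κ i (1ℤ + x)
    by (yes p) (yes refl) = 1≰0 (p ⊢ solve (x ∷ []))
    by (yes p) (no q) rewrite θ-≤ p | κ-≢ q = θ-≤ (≤-trans p (i≤suc[i] x))
    by (no p) (yes refl) rewrite θ-≰ p | κ-refl {1ℤ + x} refl = θ-≤ {1ℤ + x} ≤-refl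
    by (no p) (no q) rewrite θ-≰ p | κ-≢ q =
      θ-≰ λ le → q (≤-antisym le (i<j⇒suc[i]≤j (≰⇒> p)))

  θ-drop : ∀ i x → θ i x ≡ θ (1ℤ + i) x + κ i x
  θ-drop i x = trans (sym (θ-shift i x)) (trans (θ-suc (1ℤ + i) x)
    (cong (λ y → θ (1ℤ + i) x + y) (κ-cong {1ℤ + i} {1ℤ + x} {i} {x} suc-injective (cong λ y → 1ℤ + y))))

  Bit : ℤ → Set
  Bit x = x ≡ 0ℤ ⊎ x ≡ 1ℤ

  if-bit : ∀ b → Bit (if b then 1ℤ else 0ℤ)
  if-bit true = inj₂ refl
  if-bit false = inj₁ refl

  bit-nonneg : ∀ {x} → Bit x → 0ℤ ≤ x
  bit-nonneg (inj₁ refl) = ≤-refl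
  bit-nonneg (inj₂ refl) = 0≤+ 1

  bit-*-nonneg : ∀ {x y} → Bit x → 0ℤ ≤ y → 0ℤ ≤ x * y
  bit-*-nonneg (inj₁ refl) _ = ≤-refl
  bit-*-nonneg {y = y} (inj₂ refl) p = subst (0ℤ ≤_) (sym (*-identityˡ y)) p

  bit-*-≤ : ∀ {x y} → Bit x → 0ℤ ≤ y → x * y ≤ 1ℤ * y
  bit-*-≤ {y = y} (inj₁ refl) p = subst (0ℤ ≤_) (sym (*-identityˡ y)) p
  bit-*-≤ (inj₂ refl) p = ≤-refl

  bit-complement : ∀ {x} → Bit x → Bit (1ℤ - x)
  bit-complement (inj₁ refl) = inj₂ refl
  bit-complement (inj₂ refl) = inj₁ refl

  0≤χ : ∀ {n} (X : Subset n) a → 0ℤ ≤ χ X a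
  0≤χ X a = bit-nonneg (if-bit (lookup X a))

  count : ∀ {n} → (Fin n → ℤ) → Config n → ℤ → ℤ
  count w p i = sum (λ a → w a * θ i (p a))

  one : ∀ {n} → Fin n → ℤ
  one _ = 1ℤ

  at : ∀ {n} → Config n → ℤ → Subset n
  at p i = tabulate (λ a → does (i ≟ p a))

  χ-at : ∀ {n} (p : Config n) i a → χ (at p i) a ≡ κ i (p a)
  χ-at p i a = cong (λ b → if b then 1ℤ else 0ℤ) (lookup∘tabulate _ a)

  ∈-at : ∀ {n} (p : Config n) i a → a ∈ at p i → p a ≡ i
  ∈-at p i a a∈ with i ≟ p a | χ-at p i a
  ... | yes eq | _ = sym eq
  ... | no _ | e = 1≰0 (≤-reflexive (trans (sym (χ-∈ a∈)) e))

  ∈-at⁺ : ∀ {n} (p : Config n) {i a} → p a ≡ i → a ∈ at p i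
  ∈-at⁺ p {i} {a} eq = lookup⇒[]= a (at p i) (trans (lookup∘tabulate _ a) (dec-true (i ≟ p a) (sym eq)))

  count-drop : ∀ {n} (p : Config n) i → count one p i ≡ count one p (1ℤ + i) + + size (at p i)
  count-drop p i = trans (sum-cong _ _ pointwise)
    (trans (sum-+ (λ a → 1ℤ * θ (1ℤ + i) (p a)) (χ (at p i)))
      (cong (λ x → count one p (1ℤ + i) + x) (sum-χ (at p i))))
    where
    go : ∀ x y → 1ℤ * (x + y) ≡ 1ℤ * x + y
    go x y = solve (x ∷ y ∷ [])
    pointwise : ∀ a → 1ℤ * θ i (p a) ≡ 1ℤ * θ (1ℤ + i) (p a) + χ (at p i) a
    pointwise a rewrite θ-drop i (p a) | χ-at p i a = go (θ (1ℤ + i) (p a)) (κ i (p a))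

  counts : ∀ {n} {w : Fin n → ℤ} → (∀ a → Bit (w a)) → ∀ p → Counts (sum w) (count one p) (count w p)
  counts {n} {w} bit p = record
    { bounded = λ i → sum-mono _ _ λ a → w*θ≤w i a (if-bit (does (i ≤? p a)))
    ; below = λ i → sum-mono _ _ λ a → bit-*-≤ (bit a) (0≤θ i a)
    ; antitone = λ i → sum-mono _ _ λ a → go (w a) (θ (1ℤ + i) (p a)) (θ i (p a)) (κ i (p a))
        (θ-drop i (p a)) (bit-*-nonneg (bit a) (0≤κ i (p a)))
    ; dominated = λ i → go′ (count w p i) (count w p (1ℤ + i)) (count one p i) (count one p (1ℤ + i)) (sums i)
    }
    where
    0≤θ : ∀ i a → 0ℤ ≤ θ i (p a)
    0≤θ i a = bit-nonneg (if-bit (does (i ≤? p a)))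
    w*θ≤w : ∀ i a → Bit (θ i (p a)) → w a * θ i (p a) ≤ w a
    w*θ≤w i a (inj₁ eq) rewrite eq | *-zeroʳ (w a) = bit-nonneg (bit a)
    w*θ≤w i a (inj₂ eq) rewrite eq | *-identityʳ (w a) = ≤-refl
    go : ∀ w t t′ k → t′ ≡ t + k → 0ℤ ≤ w * k → w * t ≤ w * t′
    go w t _ k refl p = p ⊢ solve (w ∷ t ∷ k ∷ [])
    go′ : ∀ s s′ n n′ → s + n′ ≤ n + s′ → s - s′ ≤ n - n′
    go′ s s′ n n′ p = p ⊢ solve (s ∷ s′ ∷ n ∷ n′ ∷ [])
    go″ : ∀ w t t′ k → t′ ≡ t + k → w * k ≤ 1ℤ * k → w * t′ + 1ℤ * t ≤ 1ℤ * t′ + w * t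
    go″ w t _ k refl p = p ⊢ solve (w ∷ t ∷ k ∷ [])
    sums : ∀ i → count w p i + count one p (1ℤ + i) ≤ count one p i + count w p (1ℤ + i)
    sums i = subst₂ _≤_
      (sum-+ (λ a → w a * θ i (p a)) (λ a → 1ℤ * θ (1ℤ + i) (p a)))
      (sum-+ (λ a → 1ℤ * θ i (p a)) (λ a → w a * θ (1ℤ + i) (p a)))
      (sum-mono _ _ λ a → go″ (w a) (θ (1ℤ + i) (p a)) (θ i (p a)) (κ i (p a))
        (θ-drop i (p a)) (bit-*-≤ (bit a) (0≤κ i (p a))))

  initial : ∀ {n} (w : Fin n → ℤ) → Initial (+ n) (sum w) (count (one {n}) allAtOrigin) (count w allAtOrigin)
  initial {n} w = record
    { N-left = λ i≤0 → trans (left (one {n}) i≤0) (sum-ones n)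
    ; S-left = left w
    ; N-right = right (one {n})
    ; S-right = right w
    }
    where
    left : ∀ (w : Fin n → ℤ) {i} → i ≤ 0ℤ → count w allAtOrigin i ≡ sum w
    left w i≤0 rewrite θ-≤ i≤0 = sum-cong _ _ λ a → *-identityʳ (w a)
    right : ∀ (w : Fin n → ℤ) k → count w allAtOrigin +[1+ k ] ≡ 0ℤ
    right w k = sum-zero _ λ a → *-zeroʳ (w a)

  size-∪ : ∀ {n} (p q : Subset n) → (∀ a → a ∈ p → a ∉ q) → size (p ∪ q) ≡ size p ℕ.+ size q
  size-∪ p q disjoint = +-injective (begin
    + size (p ∪ q)              ≡⟨ sum-χ (p ∪ q) ⟨
    sum (χ (p ∪ q))             ≡⟨ sum-cong _ _ pointwise ⟩
    sum (λ a → χ p a + χ q a)   ≡⟨ sum-+ (χ p) (χ q) ⟩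
    sum (χ p) + sum (χ q)       ≡⟨ cong₂ _+_ (sum-χ p) (sum-χ q) ⟩
    + (size p ℕ.+ size q)       ∎)
    where
    open ≡-Reasoning
    pointwise : ∀ a → χ (p ∪ q) a ≡ χ p a + χ q a
    pointwise a with a ∈? p | a ∈? q
    ... | yes a∈p | yes a∈q = contradiction a∈q (disjoint a a∈p)
    ... | yes a∈p | no a∉q rewrite χ-∈ a∈p | χ-∉ a∉q = χ-∈ {X = p ∪ q} (x∈p∪q⁺ {p = p} {q = q} (inj₁ a∈p))
    ... | no a∉p | yes a∈q rewrite χ-∉ a∉p | χ-∈ a∈q = χ-∈ {X = p ∪ q} (x∈p∪q⁺ {p = p} {q = q} (inj₂ a∈q))
    ... | no a∉p | no a∉q rewrite χ-∉ a∉p | χ-∉ a∉q = χ-∉ {X = p ∪ q} ([ a∉p , a∉q ]′ ∘ x∈p∪q⁻ p q)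

  ∈─⇒∉ : ∀ {n} {p q : Subset n} {a} → a ∈ p ─ q → a ∉ q
  ∈─⇒∉ {p = _ Vec.∷ _} {true Vec.∷ _} () Vec.here
  ∈─⇒∉ {p = _ Vec.∷ _} {_ Vec.∷ _} (Vec.there a∈) (Vec.there a∈q) = ∈─⇒∉ a∈ a∈q

  size-≤-split : ∀ {n} (p q : Subset n) → size p ℕ.≤ size q ℕ.+ size (p ─ q)
  size-≤-split p q = ℕ.≤-trans (p⊆q⇒∣p∣≤∣q∣ covered) 
    (ℕ.≤-reflexive (size-∪ q (p ─ q) λ a a∈q a∈ → ∈─⇒∉ a∈ a∈q))
    where
    covered : p ⊆ q ∪ (p ─ q)
    covered {a} a∈p with a ∈? q
    ... | yes a∈q = x∈p∪q⁺ (inj₁ a∈q)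
    ... | no a∉q = x∈p∪q⁺ (inj₂ (x∈p∧x∉q⇒x∈p─q a∈p a∉q))

  -- Selecting chips by label

  module Labels {c ℓ₁ ℓ₂ : Level} (O : StrictTotalOrder c ℓ₁ ℓ₂) where
    open StrictTotalOrder O using (Carrier; _≈_; compare)
      renaming (_<_ to _≺_; trans to ≺-trans; irrefl to ≺-irrefl; module Eq to ≈)

    Minimum : ∀ {n} → (Fin n → Carrier) → Subset n → Fin n → Set ℓ₂
    Minimum label X x = x ∈ X × (∀ b → b ∈ X → ¬ b ≡ x → label x ≺ label b)

    minimum : ∀ {n} (label : Fin n → Carrier) → Injective _≡_ _≈_ label →
      ∀ {X : Subset n} → Nonempty X → ∃ (Minimum label X)
    minimum label inj {false Vec.∷ X} (suc a , Vec.there a∈)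
      with minimum (label ∘ suc) (Fin.suc-injective ∘ inj) (a , a∈)
    ... | x , x∈ , least = suc x , Vec.there x∈ ,
      λ { (suc b) (Vec.there b∈) b≢x → least b b∈ (b≢x ∘ cong suc) }
    minimum label inj {true Vec.∷ X} _ with nonempty? X
    ... | no empty = zero , Vec.here ,
      λ { zero _ b≢x → contradiction refl b≢x ; (suc b) (Vec.there b∈) _ → contradiction (b , b∈) empty }
    ... | yes nonempty with minimum (label ∘ suc) (Fin.suc-injective ∘ inj) nonempty
    ...   | x , x∈ , least with compare (label zero) (label (suc x))
    ...     | tri≈ _ eq _ = contradiction (inj eq) λ ()
    ...     | tri> _ _ x≺0 = suc x , Vec.there x∈ ,
      λ { zero _ _ → x≺0 ; (suc b) (Vec.there b∈) b≢x → least b b∈ (b≢x ∘ cong suc) }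
    ...     | tri< 0≺x _ _ = zero , Vec.here , above
      where
      above : ∀ b → b ∈ true Vec.∷ X → ¬ b ≡ zero → label zero ≺ label b
      above zero _ b≢0 = contradiction refl b≢0
      above (suc b) (Vec.there b∈) _ with b Fin.≟ x
      ... | yes refl = 0≺x
      ... | no b≢x = ≺-trans 0≺x (least b b∈ b≢x)

    record Lowest {n} (label : Fin n → Carrier) (k : ℕ) (X : Subset n) : Set ℓ₂ where
      field
        chips : Subset n
        contained : chips ⊆ X
        size≡k : size chips ≡ k
        below-rest : ∀ a b → a ∈ chips → b ∈ X → b ∉ chips → label a ≺ label b

    -- The minimum is taken out `k` times, each time lying below all that remains.
    lowest : ∀ {n} (label : Fin n → Carrier) → Injective _≡_ _≈_ label →
      ∀ k (X : Subset n) → k ℕ.≤ size X → Lowest label k X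
    lowest {n} label inj ℕ.zero X _ = record
      { chips = Subset.⊥
      ; contained = λ a∈ → contradiction a∈ ∉⊥
      ; size≡k = ∣⊥∣≡0 n
      ; below-rest = λ a b a∈ → contradiction a∈ ∉⊥
      }
    lowest {n} label inj (ℕ.suc k) X k<size with nonempty? X
    ... | no empty = contradiction
      (ℕ.≤-trans k<size (ℕ.≤-reflexive (trans (cong size (Empty-unique empty)) (∣⊥∣≡0 n)))) λ ()
    ... | yes nonempty with minimum label inj nonempty
    ...   | x , x∈X , least with lowest label inj k (X ─ ⁅ x ⁆)
              (ℕ.s≤s⁻¹ (ℕ.≤-trans k<size (ℕ.≤-trans (size-≤-split X ⁅ x ⁆)
                (ℕ.≤-reflexive (cong (ℕ._+ size (X ─ ⁅ x ⁆)) (∣⁅x⁆∣≡1 x))))))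
    ...     | rest = record
      { chips = ⁅ x ⁆ ∪ chips
      ; contained = λ a∈ → [ (λ a∈x → subst (_∈ X) (sym (x∈⁅y⁆⇒x≡y x a∈x)) x∈X) , p─q⊆p X ⁅ x ⁆ ∘ contained ]′
          (x∈p∪q⁻ ⁅ x ⁆ chips a∈)
      ; size≡k = trans (size-∪ ⁅ x ⁆ chips λ a a∈x a∈ → ∈─⇒∉ (contained a∈) a∈x)
          (cong₂ ℕ._+_ (∣⁅x⁆∣≡1 x) size≡k)
      ; below-rest = λ a b a∈ b∈ b∉ → below′ a b (x∈p∪q⁻ ⁅ x ⁆ chips a∈) b∈ b∉
      }
      where
      open Lowest rest
      below′ : ∀ a b → a ∈ ⁅ x ⁆ ⊎ a ∈ chips → b ∈ X → b ∉ ⁅ x ⁆ ∪ chips → label a ≺ label b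
      below′ a b (inj₁ a∈x) b∈ b∉ rewrite x∈⁅y⁆⇒x≡y x a∈x =
        least b b∈ λ { refl → b∉ (x∈p∪q⁺ (inj₁ (x∈⁅x⁆ x))) }
      below′ a b (inj₂ a∈) b∈ b∉ = below-rest a b a∈
        (x∈p∧x∉q⇒x∈p─q b∈ (b∉ ∘ x∈p∪q⁺ ∘ inj₁)) (b∉ ∘ x∈p∪q⁺ ∘ inj₂)

    -- Labeled moves and their effect on counts

    module Chips (r : ℕ) {n : ℕ} (label : Fin n → Carrier) where
      open LabeledChipFiring O r label

      -- `L` consists of the `r` lowest chips of `X` and `R` of the `r` lowest of the rest, so the
      -- bundles are disjoint and in order.
      crowded-fires : Injective _≡_ _≈_ label → ∀ {p : Config n} {site X} →
        (∀ a → a ∈ X → p a ≡ site) → r ℕ.+ r ℕ.≤ size X → ∃ (p ⟶_)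
      crowded-fires inj {p} {site} {X} at-site crowded = q , record
        { site = site
        ; chosen = L ∪ R
        ; size = trans (size-∪ L R disjoint) (trans (cong₂ ℕ._+_ (Lowest.size≡k lower) (Lowest.size≡k upper))
            (cong (r ℕ.+_) (sym (ℕ.+-identityʳ r))))
        ; atSite = λ a a∈ → at-site a ([ Lowest.contained lower , R⊆X ]′ (x∈p∪q⁻ L R a∈))
        ; left = L
        ; right = R
        ; split = refl
        ; leftSize = Lowest.size≡k lower
        ; rightSize = Lowest.size≡k upper
        ; sorted = λ a b a∈ b∈ → Lowest.below-rest lower a b a∈ (R⊆X b∈) (λ b∈L → disjoint b b∈L b∈)
        ; movesLeft = moves-left
        ; movesRight = moves-right
        ; stays = stays
        }
        where
        lower : Lowest label r X
        lower = lowest label inj r X (ℕ.≤-trans (ℕ.m≤m+n r r) crowded)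
        L = Lowest.chips lower
        upper : Lowest label r (X ─ L)
        upper = lowest label inj r (X ─ L) (ℕ.+-cancelˡ-≤ r r (size (X ─ L))
          (ℕ.≤-trans crowded (subst (λ s → size X ℕ.≤ s ℕ.+ size (X ─ L))
            (Lowest.size≡k lower) (size-≤-split X L))))
        R = Lowest.chips upper
        R⊆X : R ⊆ X
        R⊆X = p─q⊆p X L ∘ Lowest.contained upper
        disjoint : ∀ a → a ∈ L → a ∉ R
        disjoint a a∈L a∈R = ∈─⇒∉ (Lowest.contained upper a∈R) a∈L
        q : Config n
        q a with a ∈? L | a ∈? R
        ... | yes _ | _ = site - 1ℤ
        ... | no _ | yes _ = site + 1ℤ
        ... | no _ | no _ = p a
        moves-left : ∀ a → a ∈ L → q a ≡ site - 1ℤ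
        moves-left a a∈ with a ∈? L | a ∈? R
        ... | yes _ | _ = refl
        ... | no a∉ | _ = contradiction a∈ a∉
        moves-right : ∀ a → a ∈ R → q a ≡ site + 1ℤ
        moves-right a a∈ with a ∈? L | a ∈? R
        ... | yes a∈L | _ = contradiction a∈ (disjoint a a∈L)
        ... | no _ | yes _ = refl
        ... | no _ | no a∉ = contradiction a∈ a∉
        stays : ∀ a → a ∉ L ∪ R → q a ≡ p a
        stays a a∉ with a ∈? L | a ∈? R
        ... | yes a∈L | _ = contradiction (x∈p∪q⁺ (inj₁ a∈L)) a∉
        ... | no _ | yes a∈R = contradiction (x∈p∪q⁺ (inj₂ a∈R)) a∉
        ... | no _ | no _ = refl

      final-stable : Injective _≡_ _≈_ label → ∀ {p} → Final p → Stable (+ r) (count one p)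
      final-stable inj {p} final i = ≰⇒> λ N≤ →
        let q , move = crowded-fires inj (∈-at p i) (crowded N≤) in final q move
        where
        crowded : count one p (1ℤ + i) + (+ r + + r) ≤ count one p i → r ℕ.+ r ℕ.≤ size (at p i)
        crowded N≤ = drop‿+≤+ (go (count one p (1ℤ + i)) (+ r + + r) (+ size (at p i))
          (subst (count one p (1ℤ + i) + (+ r + + r) ≤_) (count-drop p i) N≤))
          where
          go : ∀ x y z → x + y ≤ x + z → y ≤ z
          go x y z p = p ⊢ solve (x ∷ y ∷ z ∷ [])

      count-move : ∀ (w : Fin n → ℤ) {p q} (move : p ⟶ q) → let open _⟶_ move in
        ∀ i → count w q i ≡ moved (count w p) site (sum λ a → w a * χ left a) (sum λ a → w a * χ right a) i
      count-move w {p} {q} move i = trans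
        (sum-cong _ _ λ a → go (w a) (θ i (q a)) (θ i (p a))
          (κ i site) (κ i (1ℤ + site)) (χ left a) (χ right a) (pointwise a))
        (sum-linear (λ a → w a * θ i (p a)) (λ a → w a * χ left a) (λ a → w a * χ right a)
          (κ i site) (κ i (1ℤ + site)))
        where
        open _⟶_ move
        go : ∀ w t′ t x y l r → t′ ≡ t - x * l + y * r → w * t′ ≡ w * t - x * (w * l) + y * (w * r)
        go w _ t x y l r refl = solve (w ∷ t ∷ x ∷ y ∷ l ∷ r ∷ [])
        in-left : ∀ t t′ k y → t ≡ t′ + k → t′ ≡ t - k * 1ℤ + y * 0ℤ
        in-left _ t′ k y refl = solve (t′ ∷ k ∷ y ∷ [])
        in-right : ∀ t t′ k x → t′ ≡ t + k → t′ ≡ t - x * 0ℤ + k * 1ℤ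
        in-right t _ k x refl = solve (t ∷ k ∷ x ∷ [])
        nowhere : ∀ t x y → t ≡ t - x * 0ℤ + y * 0ℤ
        nowhere t x y = solve (t ∷ x ∷ y ∷ [])
        back : ∀ s → 1ℤ + (s - 1ℤ) ≡ s
        back s = solve (s ∷ [])
        pointwise : ∀ a → θ i (q a) ≡ θ i (p a) - κ i site * χ left a + κ i (1ℤ + site) * χ right a
        pointwise a with a ∈? left | a ∈? right
        -- A chip in both bundles would lie below itself.
        ... | yes a∈L | yes a∈R = contradiction (sorted a a a∈L a∈R) (≺-irrefl ≈.refl)
        ... | yes a∈L | no a∉R rewrite χ-∈ a∈L | χ-∉ a∉R | movesLeft a a∈L
                | atSite a (subst (a ∈_) split (x∈p∪q⁺ (inj₁ a∈L))) =
          in-left (θ i site) (θ i (site - 1ℤ)) (κ i site) (κ i (1ℤ + site))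
            (subst (λ x → θ i x ≡ θ i (site - 1ℤ) + κ i x) (back site) (θ-suc i (site - 1ℤ)))
        ... | no a∉L | yes a∈R rewrite χ-∉ a∉L | χ-∈ a∈R | movesRight a a∈R
                | atSite a (subst (a ∈_) split (x∈p∪q⁺ (inj₂ a∈R))) | +-comm site 1ℤ =
          in-right (θ i site) (θ i (1ℤ + site)) (κ i (1ℤ + site)) (κ i site) (θ-suc i site)
        ... | no a∉L | no a∉R rewrite χ-∉ a∉L | χ-∉ a∉R
                | stays a ([ a∉L , a∉R ]′ ∘ x∈p∪q⁻ left right ∘ subst (a ∈_) (sym split)) =
          nowhere (θ i (p a)) (κ i site) (κ i (1ℤ + site))

      module _ (Small : Fin n → Set ℓ₂) (small? : ∀ a → Dec (Small a)) where

        weight : Fin n → ℤ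
        weight a = if does (small? a) then 1ℤ else 0ℤ

        weight-bit : ∀ a → Bit (weight a)
        weight-bit a = if-bit (does (small? a))

        weight-small : ∀ {a} → Small a → weight a ≡ 1ℤ
        weight-small {a} s rewrite dec-true (small? a) s = refl

        weight-large : ∀ {a} → ¬ Small a → weight a ≡ 0ℤ
        weight-large {a} s rewrite dec-false (small? a) s = refl

        move : (∀ {a b} → label b ≺ label a → Small a → Small b) → ∀ {p q} → p ⟶ q →
          Move (+ r) (count one p) (count weight p) (count one q) (count weight q)
        move closed {p} {q} step = record
          { site = site
          ; lefts = sum λ a → weight a * χ left a
          ; rights = sum λ a → weight a * χ right a
          ; N-move = λ i → trans (count-move (one {n}) step i)
              (cong₂ (λ x y → moved (count (one {n}) p) site x y i)
                (trans (sum-χ-one left) (cong +_ leftSize)) (trans (sum-χ-one right) (cong +_ rightSize)))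
          ; S-move = count-move weight step
          ; enough = subst (count one p (1ℤ + site) + (+ r + + r) ≤_) (sym (count-drop p site))
              (+-monoʳ-≤ (count one p (1ℤ + site)) (+≤+ crowded))
          ; 0≤lefts = sum-nonneg _ λ a → bit-*-nonneg (weight-bit a) (0≤χ left a)
          ; rights≤r = subst (sum (λ a → weight a * χ right a) ≤_) (trans (sum-χ-one right) (cong +_ rightSize))
              (sum-mono _ _ λ a → bit-*-≤ (weight-bit a) (0≤χ right a))
          -- One small chip in the right bundle makes the whole left bundle small, by downward
          -- closure.
          ; sorted = small-first (Fin.any? λ a → (a ∈? right) ×-dec small? a)
          }
          where
          open _⟶_ step hiding (size)
          crowded : r ℕ.+ r ℕ.≤ size (at p site)
          crowded = ℕ.≤-trans
            (ℕ.≤-reflexive (trans (cong (r ℕ.+_) (sym (ℕ.+-identityʳ r))) (sym (_⟶_.size step))))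
            (p⊆q⇒∣p∣≤∣q∣ λ {a} a∈ → ∈-at⁺ p (atSite a a∈))
          small-first : Dec (∃ λ a → a ∈ right × Small a) →
            sum (λ a → weight a * χ right a) ≡ 0ℤ ⊎ sum (λ a → weight a * χ left a) ≡ + r
          small-first (yes (a , a∈R , small)) = inj₂ (trans (sum-cong _ _ all-small)
            (trans (sum-χ left) (cong +_ leftSize)))
            where
            all-small : ∀ b → weight b * χ left b ≡ χ left b
            all-small b with b ∈? left
            ... | yes b∈L rewrite weight-small (closed (sorted b a b∈L a∈R) small) = *-identityˡ (χ left b)
            ... | no b∉L rewrite χ-∉ b∉L = *-zeroʳ (weight b)
          small-first (no none) = inj₁ (sum-zero _ all-large)
            where
            all-large : ∀ a → weight a * χ right a ≡ 0ℤ
            all-large a with a ∈? right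
            ... | yes a∈R rewrite weight-large (λ small → none (a , a∈R , small)) = *-zeroˡ (χ right a)
            ... | no a∉R rewrite χ-∉ a∉R = *-zeroʳ (weight a)

  -- The summand is `(1ℤ - w a) * (1ℤ - v a)` expanded; with `v` the indicator of being at or right
  -- of a site, the sum counts the large chips left of it.
  sum-complement-product : ∀ {n} (v w : Fin n → ℤ) →
    sum (λ a → (1ℤ - w a) - (1ℤ * v a - w a * v a)) ≡
    + n - sum w - (sum (λ a → 1ℤ * v a) - sum (λ a → w a * v a))
  sum-complement-product {n} v w = trans
    (sum-difference (λ a → 1ℤ - w a) (λ a → 1ℤ * v a - w a * v a))
    (cong₂ _-_
      (trans (sum-difference (λ _ → 1ℤ) w) (cong (λ x → x - sum w) (sum-ones n)))
      (sum-difference (λ a → 1ℤ * v a) (λ a → w a * v a)))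

  module Inversion {n : ℕ} (w : Fin n → ℤ) (bit : ∀ a → Bit (w a)) (p : Config n)
    {a b : Fin n} (small : w a ≡ 1ℤ) (large : w b ≡ 0ℤ) (inverted : p b < p a) where

    small-right : 1ℤ ≤ count w p (p a)
    small-right = subst (_≤ count w p (p a)) (cong₂ _*_ small (θ-≤ {p a} ≤-refl))
      (term≤sum (λ c → w c * θ (p a) (p c))
        (λ c → bit-*-nonneg (bit c) (bit-nonneg (if-bit (does (p a ≤? p c))))) a)

    large-left : 1ℤ ≤ + n - sum w - (count one p (p a) - count w p (p a))
    large-left = subst₂ _≤_ at-b (sum-complement-product (λ c → θ (p a) (p c)) w)
      (term≤sum (λ c → (1ℤ - w c) - (1ℤ * θ (p a) (p c) - w c * θ (p a) (p c)))
        (λ c → subst (0ℤ ≤_) (go (w c) (θ (p a) (p c)))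
          (bit-*-nonneg (bit-complement (bit c))
            (bit-nonneg (bit-complement (if-bit (does (p a ≤? p c))))))) b)
      where
      go : ∀ x y → (1ℤ - x) * (1ℤ - y) ≡ 1ℤ - x - (1ℤ * y - x * y)
      go x y = solve (x ∷ y ∷ [])
      at-b : 1ℤ - w b - (1ℤ * θ (p a) (p b) - w b * θ (p a) (p b)) ≡ 1ℤ
      at-b rewrite large | θ-≰ (<⇒≱ inverted) = refl

  -- The sorting theorem

  module Process {c ℓ₁ ℓ₂ : Level} (O : StrictTotalOrder c ℓ₁ ℓ₂) (r′ m : ℕ)
    (label : Fin (2 ℕ.* ℕ.suc r′ ℕ.* m) → StrictTotalOrder.Carrier O)
    (injective : Injective _≡_ (StrictTotalOrder._≈_ O) label) where

    open StrictTotalOrder O using ()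
      renaming (_<_ to _≺_; _<?_ to _≺?_; trans to ≺-trans; irrefl to ≺-irrefl; module Eq to ≈)
    open Labels O using (module Chips)

    r : ℕ
    r = ℕ.suc r′

    n : ℕ
    n = 2 ℕ.* r ℕ.* m

    open LabeledChipFiring O r label
    open Chips r label

    T M : ℤ
    T = + n
    M = + m

    total : T ≡ + r * (M + M)
    total = trans (pos-* (2 ℕ.* r) m) (trans (cong (_* M) (pos-* 2 r)) (go (+ r) M))
      where
      go : ∀ x y → + 2 * x * y ≡ x * (y + y)
      go x y = solve (x ∷ y ∷ [])

    module Threshold (x : Fin n) where

      -- A negated strict comparison is decidable, closed downwards by transitivity, and holds for
      -- `x` itself.
      Small : Fin n → Set ℓ₂
      Small a = ¬ label x ≺ label a

      small? : ∀ a → Dec (Small a)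
      small? a = ¬? (label x ≺? label a)

      closed : ∀ {a b} → label b ≺ label a → Small a → Small b
      closed b≺a a-small x≺b = a-small (≺-trans x≺b b≺a)

      w : Fin n → ℤ
      w = weight Small small?

      w-bit : ∀ a → Bit (w a)
      w-bit = weight-bit Small small?

      K : ℤ
      K = sum w

      open Reflection T K

      N S N~ S~ : Config n → ℤ → ℤ
      N = count one
      S = count w
      N~ p = reflectN (N p)
      S~ p = reflectS (N p) (S p)

      Small-Invariant Large-Invariant : Config n → Set
      Small-Invariant p = Sorting.Invariant m (+ r) K (N p) (S p)
      Large-Invariant p = Sorting.Invariant m (+ r) (T - K) (N~ p) (S~ p)

      N,S-counts : ∀ p → Counts K (N p) (S p)
      N,S-counts = counts w-bit

      small-initially : Small-Invariant allAtOrigin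
      small-initially = Sorting.initially m (+ r) K (N,S-counts allAtOrigin)
        (subst (λ t → Initial t K (N allAtOrigin) (S allAtOrigin)) total (initial w))

      large-initially : Large-Invariant allAtOrigin
      large-initially = Sorting.initially m (+ r) (T - K) (reflect-counts (N,S-counts allAtOrigin))
        (subst (λ t → Initial t (T - K) (N~ allAtOrigin) (S~ allAtOrigin)) total (reflect-initial (initial w)))

      small-reachable : ∀ {p q} → p ⟶* q → Small-Invariant p → Small-Invariant q
      small-reachable ε inv = inv
      small-reachable {p} (_◅_ {j = q} step steps) inv = small-reachable steps
        (Sorting.Step.preserved m (+ r) K inv (N,S-counts q) (move Small small? closed step))

      large-reachable : ∀ {p q} → p ⟶* q → Large-Invariant p → Large-Invariant q
      large-reachable ε inv = inv
      large-reachable {p} (_◅_ {j = q} step steps) inv = large-reachable steps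
        (Sorting.Step.preserved m (+ r) (T - K) inv (reflect-counts (N,S-counts q))
          (reflect-move (move Small small? closed step)))

      -- The invariants for small chips and for reflected large chips are both carried to the end;
      -- the rarer kind decides which one is used.
      not-inverted : ∀ {p} → allAtOrigin ⟶* p → Final p → ∀ {b} → label x ≺ label b → ¬ p b < p x
      not-inverted {p} reachable final {b} x≺b inverted = by (≤-total K (+ r * M))
        where
        stable : Stable (+ r) (N p)
        stable = final-stable injective final
        open Inversion w w-bit p (weight-small Small small? (≺-irrefl ≈.refl))
          (weight-large Small small? λ b-small → b-small x≺b) inverted
        N-x S-x : ℤ
        N-x = N p (p x)
        S-x = S p (p x)
        by : K ≤ + r * M ⊎ + r * M ≤ K → ⊥
        by (inj₁ few-small) = FinalState.no-inversion m
          (small-reachable reachable small-initially) (N,S-counts p) stable few-small (p x) small-right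
          (subst (λ t → N-x - S-x + 1ℤ ≤ t - K) total (arith T K N-x S-x large-left))
          where
          arith : ∀ t k n s → 1ℤ ≤ t - k - (n - s) → n - s + 1ℤ ≤ t - k
          arith t k n s p = p ⊢ solve (t ∷ k ∷ n ∷ s ∷ [])
        -- Reflection turns left of `p x` into at or right of `1ℤ - p x`, so `large-left` now
        -- supplies the small chip and `small-right` the large one.
        by (inj₂ many-small) = FinalState.no-inversion m
          (large-reachable reachable large-initially) (reflect-counts (N,S-counts p)) (reflect-stable {+ r} stable)
          (subst (λ t → t - K ≤ + r * M) (sym total) (few-large K (+ r) M many-small)) (1ℤ - p x)
          (subst (λ i → 1ℤ ≤ T - K - (N p i - S p i)) (sym flip-flip) large-left)
          (subst₂ (λ i t → N~ p (1ℤ - p x) - S~ p (1ℤ - p x) + 1ℤ ≤ t - (T - K)) {x = 1ℤ - p x} refl total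
            (subst (λ i → T - N p i - (T - K - (N p i - S p i)) + 1ℤ ≤ T - (T - K)) (sym flip-flip)
              (arith T K N-x S-x small-right)))
          where
          flip-flip : 1ℤ - (1ℤ - p x) ≡ p x
          flip-flip = go (p x)
            where
            go : ∀ i → 1ℤ - (1ℤ - i) ≡ i
            go i = solve (i ∷ [])
          few-large : ∀ k r z → r * z ≤ k → r * (z + z) - k ≤ r * z
          few-large k r z p = p ⊢ solve (k ∷ r ∷ z ∷ [])
          arith : ∀ t k n s → 1ℤ ≤ s → t - n - (t - k - (n - s)) + 1ℤ ≤ t - (t - k)
          arith t k n s p = p ⊢ solve (t ∷ k ∷ n ∷ s ∷ [])

    sorted-positions : ∀ {p} → allAtOrigin ⟶* p → Final p → ∀ a b → label a ≺ label b → p a ≤ p b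
    sorted-positions {p} reachable final a b a≺b = ≮⇒≥ (Threshold.not-inverted a reachable final a≺b)

open import Defs
open import Level using (Level)
open import Data.Nat.Base using (ℕ; suc; _*_; _≥_)
open import Data.Integer.Base using (_≤_)
open import Data.Fin.Base using (Fin)
open import Function.Definitions using (Injective)
open import Relation.Binary.Bundles using (StrictTotalOrder)
open import Relation.Binary.PropositionalEquality.Core using (_≡_)

theorem3p2 : ∀ {c ℓ₁ ℓ₂ : Level} (O : StrictTotalOrder c ℓ₁ ℓ₂) →
    let open StrictTotalOrder O in
    (r m : ℕ) → r ≥ 1 → m ≥ 1 →
    (label : Fin (2 * r * m) → Carrier) → Injective _≡_ _≈_ label →
    let open LabeledChipFiring O r label in
    (p : Config (2 * r * m)) → allAtOrigin ⟶* p → Final p →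
    (a b : Fin (2 * r * m)) → label a < label b → p a ≤ p b
theorem3p2 O (suc r′) m _ _ label injective p =
  Development.Process.sorted-positions O r′ m label injective
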